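{- Let $m,n\ge 0$ be integers with $m+n\ge 1$. For every integer $k\ge 0$ and every permutation $\sigma\in S_k$, \[ w_{\mathfrak{gl}(m|n)}(\sigma)=\Phi_{m|n}\bigl(w_{\mathfrak{gl}}(\sigma)\bigr), \] where $\Phi_{m|n}:\mathbb{C}[C_0,C_1,C_2,\dots]\to ZU(\mathfrak{gl}(m|n))$ is the algebra homomorphism sending $C_0\mapsto (m-n)\cdot 1$ and $C_j\mapsto C_j^{(m|n)}$ for $j\ge 1$. In words: the $\mathfrak{gl}(m|n)$-weight system on permutations is obtained from the universal $\mathfrak{gl}$-weight system by substituting $m-n$ for $C_0$ and the $j$-th Casimir element of $\mathfrak{gl}(m|n)$ for $C_j$, $j>0$.
   Context: The Lie superalgebra $\mathfrak{gl}(m|n)$ (over $\mathbb{C}$) has basis the matrix units $E_{ij}$, $1\le i,j\le m+n$. Put $\bar i=0$ if $i\le m$ and $\bar i=1$ if $i>m$; $E_{ij}$ has parity $\bar i+\bar j\in\mathbb{Z}_2$. The bracket is $[E_{ij},E_{kl}]=\delta_{jk}E_{il}-(-1)^{(\bar i+\bar j)(\bar k+\bar l)}\delta_{il}E_{kj}$. $U(\mathfrak{gl}(m|n))$ is the universal enveloping algebra, i.e. the tensor algebra modulo the relations $xy-(-1)^{|x||y|}yx=[x,y]$ for homogeneous $x,y$, and $ZU(\mathfrak{gl}(m|n))$ its center. The Casimir elements are $C_j^{(m|n)}=\sum_{i_1,\dots,i_j=1}^{m+n}(-1)^{\bar i_2+\cdots+\bar i_j}E_{i_1i_2}E_{i_2i_3}\cdots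 E_{i_{j-1}i_j}E_{i_ji_1}$ for $j\ge1$; they are central. Digraph and sign function. To $\sigma\in S_k$ associate the digraph with vertices $1,\dots,k$ placed in increasing order on a horizontal line and edges $x\to\sigma(x)$. For the edge $x\to y$ consider the shifted endpoints $x+\tfrac13$ and $y-\tfrac13$. The edge is distinguished if $x<y$. Two distinct edges form a distinguished pair if their shifted endpoint pairs alternate on the line (exactly one shifted endpoint of one edge lies strictly between the two shifted endpoints of the other). For a labelling $i:\{\text{edges}\}\to\{1,\dots,m+n\}$, set $f_\sigma=\sum_{e\text{ distinguished}}\bar i_e+\sum_{\{e,e'\}\text{ distinguished pair}}\bar i_e\bar i_{e'}\in\mathbb{Z}_2$. Define \[ w_{\mathfrak{gl}(m|n)}(\sigma)=\sum_{i}(-1)^{f_\sigma}E_{i_{\mathrm{in}(1)}i_{\mathrm{out}(1)}}E_{i_{\mathrm{in}(2)}i_{\mathrm{out}(2)}}\cdots E_{i_{\mathrm{in}(k)}i_{\mathrm{out}(k)}}\in U(\mathfrak{gl}(m|n)), \] where $\mathrm{in}(v)$ and $\mathrm{out}(v)$ are the edges entering and leaving vertex $v$, and the sum is over all labellings. Equivalently, labelling the edge $\sigma^{ -1}(j)\to j$ by $i_j$, this is $\sum_{i_1,\dots,i_k}(-1)^{f_\sigma}E_{i_1i_{\sigma(1)}}\cdots E_{i_ki_{\sigma(k)}}$. For $k=0$ the value is $1$. Universal $\mathfrak{gl}$-weight system. $w_{\mathfrak{gl}}$ is the function on permutations (all $k\ge0$) with values in the polynomial ring $\mathbb{C}[C_0,C_1,C_2,\dots]$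 uniquely determined by the following rules. (i) $w_{\mathfrak{gl}}$ of the empty permutation ($k=0$) is $1$. (ii) Multiplicativity under concatenation: if $\sigma\in S_k$ and $\rho\in S_j$, and $\sigma\sqcup\rho\in S_{k+j}$ acts as $\sigma$ on $\{1,\dots,k\}$ and as $x\mapsto k+\rho(x-k)$ on $\{k+1,\dots,k+j\}$, then $w_{\mathfrak{gl}}(\sigma\sqcup\rho)=w_{\mathfrak{gl}}(\sigma)w_{\mathfrak{gl}}(\rho)$. (iii) For the cycle $1\mapsto2\mapsto\cdots\mapsto k\mapsto1$ the value is $C_k$. (iv) Recurrence. Let $\sigma\in S_k$ and $1\le l<k$, put $\tau=(l\ l{+}1)$ and $\sigma'=\tau\sigma\tau$. For a permutation $\pi$ of $\{1,\dots,k\}$ with $\pi(l+1)\ne l+1$, let $D(\pi)\in S_{k-1}$ be obtained from the permutation of $\{1,\dots,k\}\setminus\{l+1\}$ given by $x\mapsto\pi(x)$ if $\pi(x)\ne l+1$ and $x\mapsto\pi(l+1)$ if $\pi(x)=l+1$, by relabelling $x\mapsto x-1$ for $x>l+1$. - If $\sigma(l)\ne l+1$ and $\sigma(l+1)\ne l$, then $w_{\mathfrak{gl}}(\sigma)-w_{\mathfrak{gl}}(\sigma')=w_{\mathfrak{gl}}(D(\sigma\tau))-w_{\mathfrak{gl}}(D(\sigma'\tau))$. Pictorially: $D(\sigma\tau)$ merges $l,l+1$ into a single vertex, joins the edge entering $l+1$ with the edge leaving $l$ into one edge, and makes the edge entering $l$ and the edge leaving $l+1$ the incoming and outgoing edges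 of the merged vertex. - If $\sigma(l+1)=l$ and $\sigma(l)\ne l+1$, write $a=\sigma^{ -1}(l+1)$ and $b=\sigma(l)$. Let $\rho\in S_{k-2}$ be obtained by deleting $l,l+1$ and setting $a\mapsto b$, and let $\rho'\in S_{k-1}$ be obtained by replacing $l,l+1$ with one vertex $l'$ with $a\mapsto l'\mapsto b$ (after order-preserving relabelling). Then $w_{\mathfrak{gl}}(\sigma)-w_{\mathfrak{gl}}(\sigma')=C_1\,w_{\mathfrak{gl}}(\rho)-C_0\,w_{\mathfrak{gl}}(\rho')$. -}

module Defs where

open import Level using (Level; _⊔_)
open import Data.Nat using (ℕ; zero; suc; _<ᵇ_; _≤ᵇ_)
import Data.Nat as ℕ
open import Data.Fin using (Fin; zero; suc; toℕ; inject₁; _↑ˡ_; _↑ʳ_; splitAt; punchIn; punchOut; _≟_)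
open import Data.Bool using (Bool; true; false; _xor_; _∧_; _∨_; if_then_else_)
open import Data.Sum using ([_,_]′)
open import Data.Vec using (Vec; lookup; tabulate)
open import Data.List using (List; foldr; map; concatMap; allFin)
open import Data.Product using (_×_)
open import Relation.Nullary using (yes; no; does)
open import Relation.Binary.PropositionalEquality using (_≡_; _≢_)
open import Algebra.Bundles using (Ring; CommutativeRing)

-- Permutations of {0,…,k-1} (0-based; vertex x here is vertex x+1 of the
-- paper), represented by the vector of images (so equality is extensional).

Perm : ℕ → Set
Perm k = Vec (Fin k) k

IsPerm : ∀ {k} → Perm k → Set
IsPerm {k} σ = (x y : Fin k) → lookup σ x ≡ lookup σ y → x ≡ y

_⊔ₚ_ : ∀ {k j} → Perm k → Perm j → Perm (k ℕ.+ j)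
_⊔ₚ_ {k} {j} σ ρ =
  tabulate λ x → [ (λ a → lookup σ a ↑ˡ j) , (λ b → k ↑ʳ lookup ρ b) ]′ (splitAt k x)

sucOrZero : ∀ {k} → Fin (suc k) → Fin (suc (suc k))
sucOrZero zero = zero
sucOrZero (suc j) = suc (suc j)

cyc : ∀ {k} → Fin (suc k) → Fin (suc k)
cyc {zero} zero = zero
cyc {suc k} zero = suc zero
cyc {suc k} (suc i) = sucOrZero (cyc {k} i)

cyclePerm : (k : ℕ) → Perm (suc k)
cyclePerm k = tabulate cyc

swapAt : ∀ {k} → Fin k → Fin (suc k) → Fin (suc k)
swapAt l x with x ≟ inject₁ l
... | yes _ = suc l
... | no _ with x ≟ suc l
...   | yes _ = inject₁ l
...   | no _ = x

conjτ : ∀ {k} → Fin k → Perm (suc k) → Perm (suc k)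
conjτ l σ = tabulate λ x → swapAt l (lookup σ (swapAt l x))

compτ : ∀ {k} → Fin k → Perm (suc k) → Perm (suc k)
compτ l σ = tabulate λ x → lookup σ (swapAt l x)

-- Deleting vertex v of π with bypass: every x ≠ v goes to π(x), unless
-- π(x) = v, in which case it goes to π(v); then order-preserving relabelling.
-- (The branch returning the dummy d never happens when π is a permutation
-- with π(v) ≠ v.)
del : ∀ {k} → Fin (suc k) → Perm (suc k) → Perm k
del {k} v π = tabulate λ x → relabel x (bypass (lookup π (punchIn v x)))
  where
  bypass : Fin (suc k) → Fin (suc k)
  bypass y with y ≟ v
  ... | yes _ = lookup π v
  ... | no _ = y
  relabel : Fin k → Fin (suc k) → Fin k
  relabel d y with v ≟ y
  ... | yes _ = d
  ... | no p = punchOut p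

D : ∀ {k} → Fin k → Perm (suc k) → Perm k
D l π = del (suc l) π

record IsUniversalGlWS {p ℓ} (P : CommutativeRing p ℓ)
         (c : ℕ → CommutativeRing.Carrier P)
         (W : (k : ℕ) → Perm k → CommutativeRing.Carrier P) : Set (p ⊔ ℓ) where
  open CommutativeRing P
  field
    empty : (σ : Perm 0) → W 0 σ ≈ 1#
    concat : ∀ {k j} (σ : Perm k) (ρ : Perm j) → IsPerm σ → IsPerm ρ →
             W (k ℕ.+ j) (σ ⊔ₚ ρ) ≈ W k σ * W j ρ
    cycle : (k : ℕ) → W (suc k) (cyclePerm k) ≈ c (suc k)
    recur₁ : ∀ {k} (l : Fin (suc k)) (σ : Perm (suc (suc k))) → IsPerm σ →
             lookup σ (inject₁ l) ≢ suc l → lookup σ (suc l) ≢ inject₁ l →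
             W (suc (suc k)) σ - W (suc (suc k)) (conjτ l σ)
               ≈ W (suc k) (D l (compτ l σ)) - W (suc k) (D l (compτ l (conjτ l σ)))
    -- (iv), second case: ρ' = D l σ (merge l, l+1 into l'), ρ = del l ρ'
    recur₂ : ∀ {k} (l : Fin (suc k)) (σ : Perm (suc (suc k))) → IsPerm σ →
             lookup σ (suc l) ≡ inject₁ l → lookup σ (inject₁ l) ≢ suc l →
             W (suc (suc k)) σ - W (suc (suc k)) (conjτ l σ)
               ≈ c 1 * W k (del l (D l σ)) - c 0 * W (suc k) (D l σ)

-- The gl(m|n) side, inside an arbitrary ring R with elements E a b
-- (a, b : Fin (m ℕ.+ n), 0-based) satisfying the defining relations of
-- U(gl(m|n)).

module GlMN {r ℓ} (R : Ring r ℓ) (m n : ℕ)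
            (E : Fin (m ℕ.+ n) → Fin (m ℕ.+ n) → Ring.Carrier R) where
  open Ring R

  N : ℕ
  N = m ℕ.+ n

  par : Fin N → Bool
  par a = m ≤ᵇ toℕ a

  sgn : Bool → Carrier
  sgn b = if b then - 1# else 1#

  δ : Fin N → Fin N → Carrier → Carrier
  δ a b x = if does (a ≟ b) then x else 0#

  natR : ℕ → Carrier
  natR zero = 0#
  natR (suc k) = 1# + natR k

  SatisfiesRelations : Set ℓ
  SatisfiesRelations = (a b c d : Fin N) →
    let s = sgn ((par a xor par b) ∧ (par c xor par d)) in
    E a b * E c d - s * (E c d * E a b) ≈ δ b c (E a d) - s * δ a d (E c b)

  sumFin : (Fin N → Carrier) → Carrier
  sumFin f = foldr (λ a acc → f a + acc) 0# (allFin N)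

  cons : ∀ {k} → Fin N → (Fin k → Fin N) → Fin (suc k) → Fin N
  cons a i zero = a
  cons a i (suc x) = i x

  sumLab : (k : ℕ) → ((Fin k → Fin N) → Carrier) → Carrier
  sumLab zero f = f (λ ())
  sumLab (suc k) f = sumFin (λ a → sumLab k (λ i → f (cons a i)))

  prodFin : (k : ℕ) → (Fin k → Carrier) → Carrier
  prodFin k g = foldr (λ x acc → g x * acc) 1# (allFin k)

  xorL : List Bool → Bool
  xorL = foldr _xor_ false

  -- digraph data; edge number x goes from x to σ(x) and carries label i(σ x)
  distinguished : ∀ {k} → Perm k → Fin k → Bool
  distinguished σ x = toℕ x <ᵇ toℕ (lookup σ x)

  -- shifted endpoints, scaled by 3 (and shifted by 1): x+1/3 ↦ 3x+2, y-1/3 ↦ 3y+1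
  startP : ∀ {k} → Perm k → Fin k → ℕ
  startP σ x = 3 ℕ.* toℕ x ℕ.+ 2
  endP : ∀ {k} → Perm k → Fin k → ℕ
  endP σ x = 3 ℕ.* toℕ (lookup σ x) ℕ.+ 1

  between : ℕ → ℕ → ℕ → Bool
  between q a b = ((a <ᵇ q) ∧ (q <ᵇ b)) ∨ ((b <ᵇ q) ∧ (q <ᵇ a))

  alternate : ∀ {k} → Perm k → Fin k → Fin k → Bool
  alternate σ x y = between (startP σ y) (startP σ x) (endP σ x)
                xor between (endP σ y) (startP σ x) (endP σ x)

  fσ : ∀ {k} → Perm k → (Fin k → Fin N) → Bool
  fσ {k} σ i =
    xorL (map (λ x → distinguished σ x ∧ par (i (lookup σ x))) (allFin k))
    xor
    xorL (concatMap (λ x → map (λ y → (toℕ x <ᵇ toℕ y) ∧ alternate σ x y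
                                        ∧ par (i (lookup σ x)) ∧ par (i (lookup σ y)))
                               (allFin k))
                    (allFin k))

  wglmn : (k : ℕ) → Perm k → Carrier
  wglmn k σ = sumLab k (λ i → sgn (fσ σ i) * prodFin k (λ x → E (i x) (i (lookup σ x))))

  -- Casimir C_{j+1}^{(m|n)} = Σ (-1)^{bar i_2+⋯+bar i_{j+1}} E_{i_1 i_2} ⋯ E_{i_{j+1} i_1}
  casimir : (j : ℕ) → Carrier
  casimir j = sumLab (suc j) (λ i →
    sgn (xorL (map (λ t → par (i (suc t))) (allFin j)))
    * prodFin (suc j) (λ t → E (i t) (i (cyc t))))

{-# OPTIONS --safe #-}

-- Writing e x for the parity of the label of the edge x → σ x, the sign function is the quadratic form
--   f_σ = Σ_{x,y} e x · e y · ([x < σ y] + [x < y][σ x < σ y])   over 𝔽₂,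
-- a sum over all ordered pairs, which makes it easy to follow under reindexing: conjugation by τ = (l l+1)
-- changes it by the product of the parities of the matrix units at l and l+1, and joining two consecutive
-- edges with equal labels, or deleting an edge l → l or l → l+1, changes it by at most a linear term.
-- Hence w(σ) − w(τστ) is the sum over labellings of a product containing a supercommutator, whose two terms
-- are the right-hand sides of the recurrence; an edge l → l+1 frees a label and yields Σ (−1)^ī = m − n,
-- and a fixed point yields the central element Σ E_ii. So w and Φ ∘ W satisfy the same rules, and these
-- determine the value at σ by induction on k: conjugations by adjacent transpositions bring σ to the form
-- (standard cycle) ⊔ ρ.
module Submission where

open import Defs
open import Level using (Level)
open import Data.Nat using (ℕ; zero; suc; _≤_; _<_; _<ᵇ_; _≤ᵇ_; s≤s)
import Data.Nat as ℕ
import Data.Nat.Properties as ℕₚ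
open import Data.Fin using (Fin; zero; suc; toℕ; inject₁; fromℕ; fromℕ<; punchIn; punchOut; _≟_; _↑ˡ_; _↑ʳ_; splitAt)
import Data.Fin.Properties as Finₚ
import Data.Fin.Permutation as Permutation
open import Data.Bool using (Bool; true; false; not; _∧_; _∨_; _xor_; T)
import Data.Bool.Properties as Boolₚ
open import Data.Product using (_×_; _,_; proj₁; proj₂; ∃)
open import Data.Sum using (inj₁; inj₂; [_,_]′)
open import Data.Vec using (lookup; tabulate)
import Data.Vec.Properties as Vecₚ
import Data.Vec.Functional as Vector
open import Data.Vec.Functional.Properties using (insertAt-lookup; insertAt-punchIn; insertAt-removeAt)
import Data.List as List
import Data.List.Properties as Listₚ
open import Function using (_∘_; _∋_; id; Equivalence)
open import Relation.Nullary using (Dec; yes; no; contradiction; does)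
open import Relation.Nullary.Decidable using (dec-true; dec-false)
open import Relation.Binary.PropositionalEquality as ≡ using (_≡_; _≢_; cong; cong₂; subst)
import Relation.Binary.Reasoning.Setoid
open import Algebra.Bundles using (Ring; CommutativeRing)
open import Algebra.Morphism.Structures using (module RingMorphisms)
import Algebra.Properties.Ring
import Algebra.Properties.Semiring.Sum
open import Algebra.Properties.Semiring.Sum
  (CommutativeRing.semiring Boolₚ.xor-∧-commutativeRing)
  using (sum-cong-≗; sum-remove; sum-permute; ∑-distrib-+; ∑-comm; sum-replicate-zero; *-distribˡ-sum; *-distribʳ-sum)
  renaming (sum to ⨁)

-- Boolean tautologies

-- Since `a ∧ a` is `a`, the diagonal of the quadratic form is linear and counts the distinguished
-- edges, while two different edges contribute the sum of both orders, which is the parity of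
-- alternation because `[a < b] + [b < a] = 1` for `a ≠ b`. The same idempotence turns the crossing
-- of two edges with equal labels into a linear term, which is why joining them leaves no residue.
-- All cancellations at `l` and `l+1` come from one fact: no shifted endpoint lies strictly between
-- `l + 1/3` and `(l+1) - 1/3`. Only one half of the supercommutator is ever evaluated: the second
-- half for `σ` becomes, once the labels at `l` and `l+1` trade places, the first half for `τστ`.
-- The recurrence is stated for one of the two orientations of an edge between `l` and `l+1`; the
-- other orientation is reached by reading it for `τστ`, whose conjugate is `σ` again.

BoolFun : ℕ → Set
BoolFun zero = Bool
BoolFun (suc n) = Bool → BoolFun n

sameTable : ∀ n → BoolFun n → BoolFun n → Bool
sameTable zero a b = not (a xor b)
sameTable (suc n) f g = sameTable n (f true) (g true) ∧ sameTable n (f false) (g false)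

SameTable : ∀ n → BoolFun n → BoolFun n → Set
SameTable zero a b = a ≡ b
SameTable (suc n) f g = ∀ b → SameTable n (f b) (g b)

-- Proof by reflection: for concrete Boolean polynomials the hidden `T` argument evaluates to the
-- unit type and is filled in automatically, so each use only has to name its atoms.
tautology : ∀ n (f g : BoolFun n) {_ : T (sameTable n f g)} → SameTable n f g
tautology zero true true = ≡.refl
tautology zero false false = ≡.refl
tautology (suc n) f g {p} true =
  tautology n _ _ {proj₁ (Boolₚ.T-∧ .Equivalence.to p)}
tautology (suc n) f g {p} false =
  tautology n _ _ {proj₂ (Boolₚ.T-∧ {sameTable n (f true) (g true)} .Equivalence.to p)}

<ᵇ-flip : ∀ a b → a ≢ b → (b <ᵇ a) ≡ not (a <ᵇ b)
<ᵇ-flip zero zero a≢b = contradiction ≡.refl a≢b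
<ᵇ-flip zero (suc b) _ = ≡.refl
<ᵇ-flip (suc a) zero _ = ≡.refl
<ᵇ-flip (suc a) (suc b) a≢b = <ᵇ-flip a b (a≢b ∘ cong suc)

<ᵇ-irrefl : ∀ a → (a <ᵇ a) ≡ false
<ᵇ-irrefl zero = ≡.refl
<ᵇ-irrefl (suc a) = <ᵇ-irrefl a

<ᵇ-suc : ∀ a b → (a <ᵇ suc b) ≡ not (b <ᵇ a)
<ᵇ-suc zero zero = ≡.refl
<ᵇ-suc zero (suc b) = ≡.refl
<ᵇ-suc (suc a) zero = ≡.refl
<ᵇ-suc (suc a) (suc b) = <ᵇ-suc a b

suc-<ᵇ : ∀ a b → b ≢ suc a → (suc a <ᵇ b) ≡ (a <ᵇ b)
suc-<ᵇ a zero _ = ≡.refl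
suc-<ᵇ zero (suc zero) b≢ = contradiction ≡.refl b≢
suc-<ᵇ zero (suc (suc b)) _ = ≡.refl
suc-<ᵇ (suc a) (suc b) b≢ = suc-<ᵇ a b (b≢ ∘ cong suc)

-- The sign as a quadratic form

-- Edge x leaves vertex s x, enters vertex t x, and carries parity c x.
koszul : ∀ {K} (s t : Fin K → ℕ) (c : Fin K → Bool) → Bool
koszul s t c = ⨁ λ x → ⨁ λ y →
  (c x ∧ c y) ∧ ((s x <ᵇ t y) xor ((s x <ᵇ s y) ∧ (t x <ᵇ t y)))

-- The koszul summand of an ordered pair of edges plus that of the reversed pair, using [a < b] + [b < a] = 1.
crossing : (s t s′ t′ : ℕ) → Bool
crossing s t s′ t′ = (s <ᵇ t′) xor ((s′ <ᵇ t) xor ((s <ᵇ s′) xor (t′ <ᵇ t)))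

koszul-cong : ∀ {K} (s s′ t t′ : Fin K → ℕ) (c c′ : Fin K → Bool) →
  (∀ x y → (s x <ᵇ t y) ≡ (s′ x <ᵇ t′ y)) → (∀ x y → (s x <ᵇ s y) ≡ (s′ x <ᵇ s′ y)) →
  (∀ x y → (t x <ᵇ t y) ≡ (t′ x <ᵇ t′ y)) → (∀ x → c x ≡ c′ x) →
  koszul s t c ≡ koszul s′ t′ c′
koszul-cong _ _ _ _ _ _ st ss tt c = sum-cong-≗ λ x → sum-cong-≗ λ y →
  cong₂ _∧_ (cong₂ _∧_ (c x) (c y)) (cong₂ _xor_ (st x y) (cong₂ _∧_ (ss x y) (tt x y)))

-- The row and the column of `v` are split off together. Their common entry collapses to a linear
-- term by idempotence, and each remaining row entry is added to its mirror image in the column;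
-- distinct sources and targets allow a comparison to be replaced by the negation of its reverse.
koszul-remove : ∀ {K} (v : Fin (suc K)) (s t : Fin (suc K) → ℕ) (c : Fin (suc K) → Bool) →
  (∀ x → s v ≢ s (punchIn v x)) → (∀ x → t v ≢ t (punchIn v x)) →
  koszul s t c ≡
    ((c v ∧ (s v <ᵇ t v))
      xor ⨁ (λ x → (c v ∧ c (punchIn v x)) ∧ crossing (s v) (t v) (s (punchIn v x)) (t (punchIn v x))))
    xor koszul (s ∘ punchIn v) (t ∘ punchIn v) (c ∘ punchIn v)
koszul-remove v s t c s≢ t≢ = begin
  koszul s t c
    ≡⟨ sum-remove {i = v} (λ x → ⨁ (A x)) ⟩
  ⨁ (A v) xor ⨁ (λ x → ⨁ (A (p x)))
    ≡⟨ cong₂ _xor_ (sum-remove {i = v} (A v))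
         (≡.trans (sum-cong-≗ λ x → sum-remove {i = v} (A (p x)))
                (∑-distrib-+ (λ x → A (p x) v) (λ x → ⨁ λ y → A (p x) (p y)))) ⟩
  (A v v xor ⨁ (λ x → A v (p x))) xor (⨁ (λ x → A (p x) v) xor koszul (s ∘ p) (t ∘ p) (c ∘ p))
    ≡⟨ tautology 4 (λ a b d e → (a xor b) xor (d xor e)) (λ a b d e → (a xor (b xor d)) xor e)
         (A v v) _ _ _ ⟩
  (A v v xor (⨁ (λ x → A v (p x)) xor ⨁ (λ x → A (p x) v))) xor koszul (s ∘ p) (t ∘ p) (c ∘ p)
    ≡⟨ cong (_xor koszul (s ∘ p) (t ∘ p) (c ∘ p))
         (cong₂ _xor_ diagonal (≡.trans (≡.sym (∑-distrib-+ (λ x → A v (p x)) (λ x → A (p x) v))) (sum-cong-≗ symmetrise))) ⟩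
  _ ∎
  where
  open ≡.≡-Reasoning
  p = punchIn v
  A : Fin (suc _) → Fin (suc _) → Bool
  A x y = (c x ∧ c y) ∧ ((s x <ᵇ t y) xor ((s x <ᵇ s y) ∧ (t x <ᵇ t y)))
  diagonal : A v v ≡ (c v ∧ (s v <ᵇ t v))
  diagonal rewrite <ᵇ-irrefl (s v) =
    tautology 2 (λ a b → (a ∧ a) ∧ (b xor false)) _∧_ (c v) (s v <ᵇ t v)
  symmetrise : ∀ x → A v (p x) xor A (p x) v
             ≡ ((c v ∧ c (p x)) ∧ crossing (s v) (t v) (s (p x)) (t (p x)))
  symmetrise x rewrite <ᵇ-flip (s v) (s (p x)) (s≢ x) | <ᵇ-flip (t v) (t (p x)) (t≢ x) =
    tautology 6 (λ a b e f g h → ((a ∧ b) ∧ (e xor (f ∧ g))) xor ((b ∧ a) ∧ (h xor (not f ∧ not g))))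
      (λ a b e f g h → (a ∧ b) ∧ (e xor (h xor (f xor not g))))
      (c v) (c (p x)) (s v <ᵇ t (p x)) (s v <ᵇ s (p x)) (t v <ᵇ t (p x)) (s (p x) <ᵇ t v)

⨁-zero : ∀ {n} {f : Fin n → Bool} → (∀ x → f x ≡ false) → ⨁ f ≡ false
⨁-zero {n} f≡0 = ≡.trans (sum-cong-≗ f≡0) (sum-replicate-zero n)

koszul-remove-uncrossed : ∀ {K} (v : Fin (suc K)) (s t : Fin (suc K) → ℕ) (c : Fin (suc K) → Bool) →
  (∀ x → s v ≢ s (punchIn v x)) → (∀ x → t v ≢ t (punchIn v x)) →
  (∀ x → crossing (s v) (t v) (s (punchIn v x)) (t (punchIn v x)) ≡ false) →
  koszul s t c ≡ (c v ∧ (s v <ᵇ t v)) xor koszul (s ∘ punchIn v) (t ∘ punchIn v) (c ∘ punchIn v)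
koszul-remove-uncrossed v s t c s≢ t≢ uncrossed = ≡.trans (koszul-remove v s t c s≢ t≢)
  (cong (λ e → e xor koszul (s ∘ punchIn v) (t ∘ punchIn v) (c ∘ punchIn v))
    (≡.trans (cong ((c v ∧ (s v <ᵇ t v)) xor_) (⨁-zero λ x →
      ≡.trans (cong ((c v ∧ c (punchIn v x)) ∧_) (uncrossed x)) (Boolₚ.∧-zeroʳ _)))
      (Boolₚ.xor-identityʳ (c v ∧ (s v <ᵇ t v)))))

-- The loop spans the interval from `l - 1/3` to `l + 1/3`, which contains no endpoint of an edge
-- that neither leaves nor enters `l`.
crossing-loop : ∀ l s t → l ≢ s → l ≢ t → crossing l l s t ≡ false
crossing-loop l s t l≢s l≢t rewrite <ᵇ-flip l s l≢s | <ᵇ-flip l t l≢t =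
  tautology 2 (λ a b → a xor (not b xor (b xor not a))) (λ _ _ → false) (l <ᵇ t) (l <ᵇ s)

-- The edge spans the gap from `l + 1/3` to `l + 2/3`, which contains no endpoint at all.
crossing-step : ∀ l s t → crossing l (suc l) s t ≡ false
crossing-step l s t rewrite <ᵇ-suc s l | <ᵇ-suc t l =
  tautology 2 (λ a b → a xor (not b xor (b xor not a))) (λ _ _ → false) (l <ᵇ t) (l <ᵇ s)

-- The endpoints `l + 1/3` and `(l+1) - 1/3` have the same position relative to every other
-- endpoint, so their contributions cancel modulo 2 and only `a` and `b` remain.
crossing-join : ∀ l a b s t →
  crossing l b s t xor crossing a (suc l) s t ≡ crossing a b s t
crossing-join l a b s t rewrite <ᵇ-suc s l | <ᵇ-suc t l =
  tautology 6 (λ x y z w u v → (x xor (z xor (y xor w))) xor (u xor (not y xor (v xor not x))))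
    (λ x y z w u v → u xor (z xor (v xor w)))
    (l <ᵇ t) (l <ᵇ s) (s <ᵇ b) (t <ᵇ b) (a <ᵇ t) (a <ᵇ s)

-- With equal labels the crossing of the two edges counts linearly and joins their two diagonal
-- terms. The condition on `b` excludes the edge `l → l+1`, which would be joined with itself.
distinguished-join : ∀ l a b → b ≢ suc l →
  ((l <ᵇ b) xor (a <ᵇ suc l)) xor crossing l b a (suc l) ≡ (a <ᵇ b)
distinguished-join l a b b≢ rewrite <ᵇ-suc a l | suc-<ᵇ l b b≢ | <ᵇ-suc l l | <ᵇ-irrefl l =
  tautology 3 (λ x y z → (x xor not y) xor (true xor (z xor (y xor x)))) (λ _ _ z → z)
    (l <ᵇ b) (l <ᵇ a) (a <ᵇ b)

-- The edges a → l+1 and l → b, carrying the same label, are joined into a → b.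
koszul-join : ∀ {K} (v : Fin (suc (suc K))) (w : Fin (suc K)) (l : ℕ)
  (s t : Fin (suc (suc K)) → ℕ) (c : Fin (suc (suc K)) → Bool) (t′ : Fin (suc K) → ℕ) →
  (∀ x y → s x ≡ s y → x ≡ y) → (∀ x y → t x ≡ t y → x ≡ y) →
  s v ≡ l → t (punchIn v w) ≡ suc l → c (punchIn v w) ≡ c v →
  t′ w ≡ t v → (∀ x → t′ (punchIn w x) ≡ t (punchIn v (punchIn w x))) →
  koszul s t c ≡ koszul (s ∘ punchIn v) t′ (c ∘ punchIn v)
koszul-join {K} v w l s t c t′ s-inj t-inj sv tw cw t′w t′x = begin
  koszul s t c
    ≡⟨ koszul-remove v s t c (λ x e → Finₚ.punchInᵢ≢i v x (≡.sym (s-inj _ _ e)))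
                             (λ x e → Finₚ.punchInᵢ≢i v x (≡.sym (t-inj _ _ e))) ⟩
  (selfv xor ⨁ (λ x → crossv (p x))) xor koszul (s ∘ p) (t ∘ p) (c ∘ p)
    ≡⟨ cong₂ (λ A B → (selfv xor A) xor B) (sum-remove {i = w} (λ x → crossv (p x)))
         (koszul-remove w (s ∘ p) (t ∘ p) (c ∘ p)
            (λ x e → Finₚ.punchInᵢ≢i w x (Finₚ.punchIn-injective v _ _ (≡.sym (s-inj _ _ e))))
            (λ x e → Finₚ.punchInᵢ≢i w x (Finₚ.punchIn-injective v _ _ (≡.sym (t-inj _ _ e))))) ⟩
  (selfv xor (crossv (p w) xor ⨁ (λ x → crossv (q x)))) xor
    ((selfw xor ⨁ (λ x → crossw (q x))) xor koszul (s ∘ q) (t ∘ q) (c ∘ q))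
    ≡⟨ tautology 6 (λ A B C D E G → (A xor (B xor C)) xor ((D xor E) xor G))
         (λ A B C D E G → (((A xor D) xor B) xor (C xor E)) xor G)
         selfv (crossv (p w)) (⨁ (λ x → crossv (q x))) selfw (⨁ (λ x → crossw (q x)))
         (koszul (s ∘ q) (t ∘ q) (c ∘ q)) ⟩
  (((selfv xor selfw) xor crossv (p w)) xor (⨁ (λ x → crossv (q x)) xor ⨁ (λ x → crossw (q x))))
    xor koszul (s ∘ q) (t ∘ q) (c ∘ q)
    ≡⟨ cong₂ _xor_ (cong₂ _xor_ self (≡.trans (≡.sym (∑-distrib-+ (λ x → crossv (q x)) (λ x → crossw (q x)))) (sum-cong-≗ cross)))
         (koszul-cong (s ∘ q) (s ∘ q) (t ∘ q) (t′ ∘ punchIn w) (c ∘ q) (c ∘ q) (λ x y → cong (s (q x) <ᵇ_) (≡.sym (t′x y))) (λ _ _ → ≡.refl)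
            (λ x y → cong₂ _<ᵇ_ (≡.sym (t′x x)) (≡.sym (t′x y))) (λ _ → ≡.refl)) ⟩
  -- The other side is peeled in reverse: taking the joined edge `w` out of it leaves the same edges
  -- `q` as taking out both `v` and `w` before.
  _ ≡⟨ koszul-remove w (s ∘ p) t′ (c ∘ p)
            (λ x e → Finₚ.punchInᵢ≢i w x (Finₚ.punchIn-injective v _ _ (≡.sym (s-inj _ _ e))))
            (λ x e → Finₚ.punchInᵢ≢i v _ (≡.sym (t-inj _ _ (≡.trans (≡.sym t′w) (≡.trans e (t′x x)))))) ⟨
  koszul (s ∘ p) t′ (c ∘ p) ∎
  where
  open ≡.≡-Reasoning
  p = punchIn v
  q = p ∘ punchIn w
  selfv = c v ∧ (s v <ᵇ t v)
  selfw = c (p w) ∧ (s (p w) <ᵇ t (p w))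
  crossv : Fin (suc (suc K)) → Bool
  crossv y = (c v ∧ c y) ∧ crossing (s v) (t v) (s y) (t y)
  crossw : Fin (suc (suc K)) → Bool
  crossw y = (c (p w) ∧ c y) ∧ crossing (s (p w)) (t (p w)) (s y) (t y)
  self : (selfv xor selfw) xor crossv (p w) ≡ (c (p w) ∧ (s (p w) <ᵇ t′ w))
  self rewrite cw | sv | tw | t′w =
    ≡.trans (tautology 4 (λ C A B D → ((C ∧ A) xor (C ∧ B)) xor ((C ∧ C) ∧ D)) (λ C A B D → C ∧ ((A xor B) xor D))
             (c v) (l <ᵇ t v) (s (p w) <ᵇ suc l) (crossing l (t v) (s (p w)) (suc l)))
      (cong (c v ∧_) (distinguished-join l (s (p w)) (t v)
        λ e → Finₚ.punchInᵢ≢i v w (t-inj _ _ (≡.trans tw (≡.sym e)))))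
  cross : ∀ x → crossv (q x) xor crossw (q x)
        ≡ ((c (p w) ∧ c (q x)) ∧ crossing (s (p w)) (t′ w) (s (q x)) (t′ (punchIn w x)))
  cross x rewrite cw | sv | tw | t′w | t′x x =
    ≡.trans (≡.sym (Boolₚ.∧-distribˡ-xor (c v ∧ c (q x)) (crossing l (t v) (s (q x)) (t (q x))) _))
      (cong ((c v ∧ c (q x)) ∧_) (crossing-join l (s (p w)) (t v) (s (q x)) (t (q x))))

-- Deleting vertices

Perm-ext : ∀ {k} {σ ρ : Perm k} → (∀ x → lookup σ x ≡ lookup ρ x) → σ ≡ ρ
Perm-ext {σ = σ} {ρ} eq =
  ≡.trans (≡.sym (Vecₚ.tabulate∘lookup σ)) (≡.trans (Vecₚ.tabulate-cong eq) (Vecₚ.tabulate∘lookup ρ))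

module _ {k} (v : Fin (suc k)) (π : Perm (suc k)) (perm : IsPerm π) (x : Fin k) where

  -- Values of `del` are always described after `punchIn v`, that is in the old numbering, so the
  -- order-preserving relabelling never has to be computed.
  punchIn-del : lookup π (punchIn v x) ≢ v → punchIn v (lookup (del v π) x) ≡ lookup π (punchIn v x)
  punchIn-del πx≢v with lookup (del v π) x | (lookup (del v π) x ≡ _) ∋ Vecₚ.lookup∘tabulate _ x
  ... | _ | ≡.refl with lookup π (punchIn v x) ≟ v
  ...   | yes πx≡v = contradiction πx≡v πx≢v
  ...   | no _ with v ≟ lookup π (punchIn v x)
  ...     | yes v≡πx = contradiction (≡.sym v≡πx) πx≢v
  ...     | no v≢πx = Finₚ.punchIn-punchOut v≢πx

  punchIn-del-bypass : lookup π (punchIn v x) ≡ v → punchIn v (lookup (del v π) x) ≡ lookup π v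
  punchIn-del-bypass πx≡v with lookup (del v π) x | (lookup (del v π) x ≡ _) ∋ Vecₚ.lookup∘tabulate _ x
  ... | _ | ≡.refl with lookup π (punchIn v x) ≟ v
  ...   | no πx≢v = contradiction πx≡v πx≢v
  ...   | yes _ with v ≟ lookup π v
  ...     | yes v≡πv = contradiction (perm _ _ (≡.trans πx≡v v≡πv)) (Finₚ.punchInᵢ≢i v x)
  ...     | no v≢πv = Finₚ.punchIn-punchOut v≢πv

IsPerm-del : ∀ {k} (v : Fin (suc k)) (π : Perm (suc k)) → IsPerm π → IsPerm (del v π)
IsPerm-del v π perm x y eq
  with lookup π (punchIn v x) ≟ v | lookup π (punchIn v y) ≟ v
... | yes πx≡v | yes πy≡v = Finₚ.punchIn-injective v x y (perm _ _ (≡.trans πx≡v (≡.sym πy≡v)))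
... | no πx≢v | no πy≢v = Finₚ.punchIn-injective v x y (perm _ _
  (≡.trans (≡.sym (punchIn-del v π perm x πx≢v)) (≡.trans (cong (punchIn v) eq) (punchIn-del v π perm y πy≢v))))
... | yes πx≡v | no πy≢v = contradiction (perm _ _
  (≡.trans (≡.sym (punchIn-del v π perm y πy≢v)) (≡.trans (cong (punchIn v) (≡.sym eq)) (punchIn-del-bypass v π perm x πx≡v))))
  (Finₚ.punchInᵢ≢i v y)
... | no πx≢v | yes πy≡v = contradiction (perm _ _
  (≡.trans (≡.sym (punchIn-del v π perm x πx≢v)) (≡.trans (cong (punchIn v) eq) (punchIn-del-bypass v π perm y πy≡v))))
  (Finₚ.punchInᵢ≢i v x)

preimage : ∀ {k} (σ : Perm k) → IsPerm σ → ∀ y → ∃ λ x → lookup σ x ≡ y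
preimage {suc k} σ perm y with Finₚ.any? (λ x → lookup σ x ≟ y)
... | yes found = found
-- If `y` were missed, punching it out of all values would inject `Fin (suc k)` into `Fin k`.
... | no missed = contradiction
  (λ {x} {z} eq → perm x z (Finₚ.punchOut-injective (missing x) (missing z) eq))
  (Finₚ.<⇒notInjective (ℕₚ.n<1+n k))
  where
  missing : ∀ x → y ≢ lookup σ x
  missing x y≡σx = missed (x , ≡.sym y≡σx)

-- Adjacent transpositions and merging of neighbouring vertices

inject₁≢suc : ∀ {k} (l : Fin k) → inject₁ l ≢ suc l
inject₁≢suc zero ()
inject₁≢suc (suc l) eq = inject₁≢suc l (Finₚ.suc-injective eq)

swapAt-inject₁ : ∀ {k} (l : Fin k) → swapAt l (inject₁ l) ≡ suc l
swapAt-inject₁ l with inject₁ l ≟ inject₁ l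
... | yes _ = ≡.refl
... | no l≢l = contradiction ≡.refl l≢l

swapAt-suc : ∀ {k} (l : Fin k) → swapAt l (suc l) ≡ inject₁ l
swapAt-suc l with suc l ≟ inject₁ l
... | yes eq = contradiction (≡.sym eq) (inject₁≢suc l)
... | no _ with suc l ≟ suc l
...   | yes _ = ≡.refl
...   | no l≢l = contradiction ≡.refl l≢l

swapAt-other : ∀ {k} (l : Fin k) x → x ≢ inject₁ l → x ≢ suc l → swapAt l x ≡ x
swapAt-other l x x≢l x≢v with x ≟ inject₁ l
... | yes eq = contradiction eq x≢l
... | no _ with x ≟ suc l
...   | yes eq = contradiction eq x≢v
...   | no _ = ≡.refl

data SwapView {k} (l : Fin k) : Fin (suc k) → Set where
  lower : SwapView l (inject₁ l)
  upper : SwapView l (suc l)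
  other : ∀ {x} → x ≢ inject₁ l → x ≢ suc l → SwapView l x

swapView : ∀ {k} (l : Fin k) x → SwapView l x
swapView l x with x ≟ inject₁ l
... | yes ≡.refl = lower
... | no x≢l with x ≟ suc l
...   | yes ≡.refl = upper
...   | no x≢v = other x≢l x≢v

swapAt-involutive : ∀ {k} (l : Fin k) x → swapAt l (swapAt l x) ≡ x
swapAt-involutive l x with swapView l x
... | lower = ≡.trans (cong (swapAt l) (swapAt-inject₁ l)) (swapAt-suc l)
... | upper = ≡.trans (cong (swapAt l) (swapAt-suc l)) (swapAt-inject₁ l)
... | other x≢l x≢v = ≡.trans (cong (swapAt l) (swapAt-other l x x≢l x≢v)) (swapAt-other l x x≢l x≢v)

swapAt-injective : ∀ {k} (l : Fin k) {x y} → swapAt l x ≡ swapAt l y → x ≡ y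
swapAt-injective l {x} {y} eq =
  ≡.trans (≡.sym (swapAt-involutive l x)) (≡.trans (cong (swapAt l) eq) (swapAt-involutive l y))

punchIn-suc-same : ∀ {k} (l : Fin k) → punchIn (suc l) l ≡ inject₁ l
punchIn-suc-same zero = ≡.refl
punchIn-suc-same (suc l) = cong suc (punchIn-suc-same l)

punchIn-inject₁-same : ∀ {k} (l : Fin k) → punchIn (inject₁ l) l ≡ suc l
punchIn-inject₁-same zero = ≡.refl
punchIn-inject₁-same (suc l) = cong suc (punchIn-inject₁-same l)

punchIn-suc-other : ∀ {k} (l x : Fin k) → x ≢ l → punchIn (suc l) x ≡ punchIn (inject₁ l) x
punchIn-suc-other zero zero x≢l = contradiction ≡.refl x≢l
punchIn-suc-other zero (suc x) _ = ≡.refl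
punchIn-suc-other (suc l) zero _ = ≡.refl
punchIn-suc-other (suc l) (suc x) x≢l = cong suc (punchIn-suc-other l x (x≢l ∘ cong suc))

swapAt-punchIn : ∀ {k} (l x : Fin k) → swapAt l (punchIn (suc l) x) ≡ punchIn (inject₁ l) x
swapAt-punchIn l x with x ≟ l
... | yes ≡.refl = ≡.trans (cong (swapAt l) (punchIn-suc-same l))
                  (≡.trans (swapAt-inject₁ l) (≡.sym (punchIn-inject₁-same l)))
... | no x≢l = ≡.trans (swapAt-other l _
    (λ eq → Finₚ.punchInᵢ≢i (inject₁ l) x (≡.trans (≡.sym (punchIn-suc-other l x x≢l)) eq))
    (Finₚ.punchInᵢ≢i (suc l) x)) (punchIn-suc-other l x x≢l)

<ᵇ-punchIn : ∀ {k} (v : Fin (suc k)) (x y : Fin k) →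
  (toℕ (punchIn v x) <ᵇ toℕ (punchIn v y)) ≡ (toℕ x <ᵇ toℕ y)
<ᵇ-punchIn zero x y = ≡.refl
<ᵇ-punchIn (suc v) zero zero = ≡.refl
<ᵇ-punchIn (suc v) zero (suc y) = ≡.refl
<ᵇ-punchIn (suc v) (suc x) zero = ≡.refl
<ᵇ-punchIn (suc v) (suc x) (suc y) = <ᵇ-punchIn v x y

-- In the merged digraph sources are renumbered by skipping `l` and targets by skipping `l+1`: the
-- merged vertex emits the edge of `l+1` and receives the edge of `l`. This is the comparison of a
-- source with a target; the merged vertex itself gives `l+1 < l`, false as required.
<ᵇ-punchIn-merge : ∀ {k} (l x y : Fin k) →
  (toℕ (punchIn (inject₁ l) x) <ᵇ toℕ (punchIn (suc l) y)) ≡ (toℕ x <ᵇ toℕ y)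
<ᵇ-punchIn-merge zero x zero = ≡.refl
<ᵇ-punchIn-merge zero x (suc y) = ≡.refl
<ᵇ-punchIn-merge (suc l) zero zero = ≡.refl
<ᵇ-punchIn-merge (suc l) zero (suc y) = ≡.refl
<ᵇ-punchIn-merge (suc l) (suc x) zero = ≡.refl
<ᵇ-punchIn-merge (suc l) (suc x) (suc y) = <ᵇ-punchIn-merge l x y

lookup-conjτ : ∀ {k} (l : Fin k) (σ : Perm (suc k)) x →
  lookup (conjτ l σ) x ≡ swapAt l (lookup σ (swapAt l x))
lookup-conjτ l σ = Vecₚ.lookup∘tabulate λ x → swapAt l (lookup σ (swapAt l x))

lookup-compτ : ∀ {k} (l : Fin k) (σ : Perm (suc k)) x →
  lookup (compτ l σ) x ≡ lookup σ (swapAt l x)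
lookup-compτ l σ = Vecₚ.lookup∘tabulate λ x → lookup σ (swapAt l x)

IsPerm-conjτ : ∀ {k} (l : Fin k) (σ : Perm (suc k)) → IsPerm σ → IsPerm (conjτ l σ)
IsPerm-conjτ l σ perm x y eq = swapAt-injective l (perm _ _ (swapAt-injective l
  (≡.trans (≡.sym (lookup-conjτ l σ x)) (≡.trans eq (lookup-conjτ l σ y)))))

IsPerm-compτ : ∀ {k} (l : Fin k) (σ : Perm (suc k)) → IsPerm σ → IsPerm (compτ l σ)
IsPerm-compτ l σ perm x y eq = swapAt-injective l (perm _ _
  (≡.trans (≡.sym (lookup-compτ l σ x)) (≡.trans eq (lookup-compτ l σ y))))

lookup-conjτ-inject₁ : ∀ {k} (l : Fin k) (σ : Perm (suc k)) →
  lookup (conjτ l σ) (inject₁ l) ≡ swapAt l (lookup σ (suc l))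
lookup-conjτ-inject₁ l σ = ≡.trans (lookup-conjτ l σ (inject₁ l)) (cong (swapAt l ∘ lookup σ) (swapAt-inject₁ l))

lookup-conjτ-suc : ∀ {k} (l : Fin k) (σ : Perm (suc k)) →
  lookup (conjτ l σ) (suc l) ≡ swapAt l (lookup σ (inject₁ l))
lookup-conjτ-suc l σ = ≡.trans (lookup-conjτ l σ (suc l)) (cong (swapAt l ∘ lookup σ) (swapAt-suc l))

conjτ-involutive : ∀ {k} (l : Fin k) (σ : Perm (suc k)) → conjτ l (conjτ l σ) ≡ σ
conjτ-involutive l σ = Perm-ext λ x → begin
  lookup (conjτ l (conjτ l σ)) x                        ≡⟨ lookup-conjτ l (conjτ l σ) x ⟩
  swapAt l (lookup (conjτ l σ) (swapAt l x))            ≡⟨ cong (swapAt l) (lookup-conjτ l σ (swapAt l x)) ⟩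
  swapAt l (swapAt l (lookup σ (swapAt l (swapAt l x)))) ≡⟨ swapAt-involutive l (lookup σ (swapAt l (swapAt l x))) ⟩
  lookup σ (swapAt l (swapAt l x))                      ≡⟨ cong (lookup σ) (swapAt-involutive l x) ⟩
  lookup σ x                                            ∎
  where open ≡.≡-Reasoning

module _ {k} (l : Fin k) (σ : Perm (suc k)) (perm : IsPerm σ) (x : Fin k) where

  private
    π = compτ l σ
    permπ = IsPerm-compτ l σ perm
    πx = ≡.trans (lookup-compτ l σ (punchIn (suc l) x)) (cong (lookup σ) (swapAt-punchIn l x))

  -- Composition with `τ` turns the deletion of the vertex `l+1` into the deletion of the source `l`
  -- and the target `l+1`, so an edge not entering `l+1` keeps its old target.
  punchIn-D : lookup σ (punchIn (inject₁ l) x) ≢ suc l →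
    punchIn (suc l) (lookup (D l (compτ l σ)) x) ≡ lookup σ (punchIn (inject₁ l) x)
  punchIn-D σx≢v = ≡.trans (punchIn-del (suc l) π permπ x λ eq → σx≢v (≡.trans (≡.sym πx) eq)) πx

  punchIn-D-join : lookup σ (punchIn (inject₁ l) x) ≡ suc l →
    punchIn (suc l) (lookup (D l (compτ l σ)) x) ≡ lookup σ (inject₁ l)
  punchIn-D-join σx≡v = ≡.trans (punchIn-del-bypass (suc l) π permπ x (≡.trans πx σx≡v))
    (≡.trans (lookup-compτ l σ (suc l)) (cong (lookup σ) (swapAt-suc l)))

  -- Bypassing `l+1` contracts the edge `l → l+1`; the new vertex receives the edge into `l` and
  -- emits the edge out of `l+1`, the same reading of sources and targets as in `punchIn-D`.
  punchIn-D-step : lookup σ (inject₁ l) ≡ suc l →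
    punchIn (suc l) (lookup (D l σ) x) ≡ lookup σ (punchIn (inject₁ l) x)
  punchIn-D-step σl≡v with x ≟ l
  ... | yes ≡.refl = ≡.trans (punchIn-del-bypass (suc l) σ perm x (≡.trans (cong (lookup σ) (punchIn-suc-same l)) σl≡v))
                    (cong (lookup σ) (≡.sym (punchIn-inject₁-same l)))
  ... | no x≢l = ≡.trans (punchIn-del (suc l) σ perm x λ σx≡v →
      Finₚ.punchInᵢ≢i (inject₁ l) x (perm _ _ (≡.trans (cong (lookup σ) (≡.sym same)) (≡.trans σx≡v (≡.sym σl≡v)))))
      (cong (lookup σ) same)
    where same = punchIn-suc-other l x x≢l

-- Signs of permutations

-- Edges are numbered by their sources, but a label belongs to the vertex that the edge enters;
-- hence the parity of edge `x` is `c` at `lookup σ x`.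
sign : ∀ {k} → Perm k → (Fin k → Bool) → Bool
sign σ c = koszul toℕ (toℕ ∘ lookup σ) (c ∘ lookup σ)

sign-cong : ∀ {k} (σ : Perm k) {c d : Fin k → Bool} → (∀ x → c x ≡ d x) → sign σ c ≡ sign σ d
sign-cong σ {c} {d} c≗d = koszul-cong toℕ toℕ (toℕ ∘ lookup σ) (toℕ ∘ lookup σ) (c ∘ lookup σ) (d ∘ lookup σ)
  (λ _ _ → ≡.refl) (λ _ _ → ≡.refl) (λ _ _ → ≡.refl) (c≗d ∘ lookup σ)

lookup≢ : ∀ {k} (σ : Perm (suc k)) → IsPerm σ → ∀ v x → toℕ (lookup σ v) ≢ toℕ (lookup σ (punchIn v x))
lookup≢ σ perm v x eq = Finₚ.punchInᵢ≢i v x (≡.sym (perm _ _ (Finₚ.toℕ-injective eq)))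

punchIn≢ : ∀ {k} (v : Fin (suc k)) x → toℕ v ≢ toℕ (punchIn v x)
punchIn≢ v x eq = Finₚ.punchInᵢ≢i v x (≡.sym (Finₚ.toℕ-injective eq))

punchIn-del-loop : ∀ {k} (v : Fin (suc k)) (π : Perm (suc k)) → IsPerm π → lookup π v ≡ v →
  ∀ x → punchIn v (lookup (del v π) x) ≡ lookup π (punchIn v x)
punchIn-del-loop v π perm πv≡v x = punchIn-del v π perm x
  λ πx≡v → Finₚ.punchInᵢ≢i v x (perm _ _ (≡.trans πx≡v (≡.sym πv≡v)))

-- A loop is not distinguished and crosses no other edge.
sign-loop : ∀ {k} (v : Fin (suc k)) (π : Perm (suc k)) → IsPerm π → lookup π v ≡ v →
  (c : Fin (suc k) → Bool) → sign π c ≡ sign (del v π) (c ∘ punchIn v)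
sign-loop {k} v π perm πv≡v c = begin
  sign π c
    ≡⟨ koszul-remove-uncrossed v toℕ (toℕ ∘ lookup π) (c ∘ lookup π) (punchIn≢ v) (lookup≢ π perm v) uncrossed ⟩
  (c (lookup π v) ∧ (toℕ v <ᵇ toℕ (lookup π v))) xor koszul (toℕ ∘ punchIn v) (toℕ ∘ lookup π ∘ punchIn v) (c ∘ lookup π ∘ punchIn v)
    ≡⟨ cong₂ _xor_ (≡.trans (cong (λ z → c (lookup π v) ∧ (toℕ v <ᵇ toℕ z)) πv≡v)
                      (≡.trans (cong (c (lookup π v) ∧_) (<ᵇ-irrefl (toℕ v))) (Boolₚ.∧-zeroʳ _)))
         (koszul-cong (toℕ ∘ punchIn v) toℕ (toℕ ∘ lookup π ∘ punchIn v) (toℕ ∘ lookup ρ)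
           (c ∘ lookup π ∘ punchIn v) (c ∘ punchIn v ∘ lookup ρ)
           (λ x y → ≡.trans (cong (λ z → toℕ (punchIn v x) <ᵇ toℕ z) (≡.sym (spec y))) (<ᵇ-punchIn v x (lookup ρ y)))
           (<ᵇ-punchIn v)
           (λ x y → ≡.trans (cong₂ (λ z w → toℕ z <ᵇ toℕ w) (≡.sym (spec x)) (≡.sym (spec y))) (<ᵇ-punchIn v (lookup ρ x) (lookup ρ y)))
           (λ x → cong c (≡.sym (spec x)))) ⟩
  sign (del v π) (c ∘ punchIn v) ∎
  where
  open ≡.≡-Reasoning
  ρ = del v π
  spec = punchIn-del-loop v π perm πv≡v
  uncrossed : ∀ x → crossing (toℕ v) (toℕ (lookup π v)) (toℕ (punchIn v x)) (toℕ (lookup π (punchIn v x))) ≡ false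
  uncrossed x = ≡.trans (cong (λ z → crossing (toℕ v) (toℕ z) (toℕ (punchIn v x)) (toℕ (lookup π (punchIn v x)))) πv≡v)
    (crossing-loop (toℕ v) (toℕ (punchIn v x)) (toℕ (lookup π (punchIn v x))) (punchIn≢ v x)
      (λ eq → lookup≢ π perm v x (≡.trans (cong toℕ πv≡v) eq)))

-- The edge `l → l+1` crosses nothing, but it is distinguished and so contributes its own parity.
sign-step : ∀ {k} (l : Fin k) (σ : Perm (suc k)) → IsPerm σ → lookup σ (inject₁ l) ≡ suc l →
  (c : Fin (suc k) → Bool) → sign σ c ≡ c (suc l) xor sign (D l σ) (c ∘ punchIn (suc l))
sign-step {k} l σ perm σl≡v c = begin
  sign σ c
    ≡⟨ koszul-remove-uncrossed (inject₁ l) toℕ (toℕ ∘ lookup σ) (c ∘ lookup σ) (punchIn≢ _) (lookup≢ σ perm _) uncrossed ⟩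
  (c (lookup σ (inject₁ l)) ∧ (toℕ (inject₁ l) <ᵇ toℕ (lookup σ (inject₁ l)))) xor
    koszul (toℕ ∘ punchIn (inject₁ l)) (toℕ ∘ lookup σ ∘ punchIn (inject₁ l)) (c ∘ lookup σ ∘ punchIn (inject₁ l))
    ≡⟨ cong₂ _xor_ self
         (koszul-cong (toℕ ∘ p) toℕ (toℕ ∘ lookup σ ∘ p) (toℕ ∘ lookup ρ)
           (c ∘ lookup σ ∘ p) (c ∘ punchIn (suc l) ∘ lookup ρ)
           (λ x y → ≡.trans (cong (λ z → toℕ (punchIn (inject₁ l) x) <ᵇ toℕ z) (≡.sym (spec y))) (<ᵇ-punchIn-merge l x (lookup ρ y)))
           (<ᵇ-punchIn (inject₁ l))
           (λ x y → ≡.trans (cong₂ (λ z w → toℕ z <ᵇ toℕ w) (≡.sym (spec x)) (≡.sym (spec y))) (<ᵇ-punchIn (suc l) (lookup ρ x) (lookup ρ y)))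
           (λ x → cong c (≡.sym (spec x)))) ⟩
  c (suc l) xor sign (D l σ) (c ∘ punchIn (suc l)) ∎
  where
  open ≡.≡-Reasoning
  ρ = D l σ
  p = punchIn (inject₁ l)
  spec = λ x → punchIn-D-step l σ perm x σl≡v
  self : (c (lookup σ (inject₁ l)) ∧ (toℕ (inject₁ l) <ᵇ toℕ (lookup σ (inject₁ l)))) ≡ c (suc l)
  self rewrite σl≡v | Finₚ.toℕ-inject₁ l | <ᵇ-suc (toℕ l) (toℕ l) | <ᵇ-irrefl (toℕ l) = Boolₚ.∧-identityʳ _
  uncrossed : ∀ x → crossing (toℕ (inject₁ l)) (toℕ (lookup σ (inject₁ l)))
    (toℕ (punchIn (inject₁ l) x)) (toℕ (lookup σ (punchIn (inject₁ l) x))) ≡ false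
  uncrossed x rewrite σl≡v | Finₚ.toℕ-inject₁ l = crossing-step (toℕ l) (toℕ (p x)) (toℕ (lookup σ (p x)))

-- The hypothesis on `c` says that the edges into `l+1` and out of `l` have the same parity, as the
-- factor `δ` of the supercommutator will ensure.
sign-join : ∀ {k} (l : Fin (suc k)) (σ : Perm (suc (suc k))) → IsPerm σ → lookup σ (inject₁ l) ≢ suc l →
  (c : Fin (suc (suc k)) → Bool) → c (suc l) ≡ c (lookup σ (inject₁ l)) →
  sign σ c ≡ sign (D l (compτ l σ)) (c ∘ punchIn (suc l))
sign-join {k} l σ perm σl≢v c cv with preimage σ perm (suc l)
... | a , σa≡v = begin
  sign σ c
    ≡⟨ koszul-join (inject₁ l) w (toℕ l) toℕ (toℕ ∘ lookup σ) (c ∘ lookup σ) (toℕ ∘ punchIn (suc l) ∘ lookup ρ)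
         (λ _ _ → Finₚ.toℕ-injective) (λ x y eq → perm x y (Finₚ.toℕ-injective eq))
         (Finₚ.toℕ-inject₁ l) (cong toℕ σw) (≡.trans (cong c σw) cv)
         (cong toℕ (punchIn-D-join l σ perm w σw)) (λ x → cong toℕ (spec x)) ⟩
  koszul (toℕ ∘ punchIn (inject₁ l)) (toℕ ∘ punchIn (suc l) ∘ lookup ρ) (c ∘ lookup σ ∘ punchIn (inject₁ l))
    ≡⟨ koszul-cong (toℕ ∘ punchIn (inject₁ l)) toℕ (toℕ ∘ punchIn (suc l) ∘ lookup ρ) (toℕ ∘ lookup ρ)
         (c ∘ lookup σ ∘ punchIn (inject₁ l)) (c ∘ punchIn (suc l) ∘ lookup ρ)
         (λ x y → <ᵇ-punchIn-merge l x (lookup ρ y)) (<ᵇ-punchIn (inject₁ l))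
         (λ x y → <ᵇ-punchIn (suc l) (lookup ρ x) (lookup ρ y)) label ⟩
  sign ρ (c ∘ punchIn (suc l)) ∎
  where
  open ≡.≡-Reasoning
  ρ = D l (compτ l σ)
  l≢a : inject₁ l ≢ a
  l≢a ≡.refl = σl≢v σa≡v
  -- `a` is the source of the edge into `l+1`; it differs from `l`, so it survives as `w` when the
  -- source `l` is removed.
  w = punchOut l≢a
  σw : lookup σ (punchIn (inject₁ l) w) ≡ suc l
  σw = ≡.trans (cong (lookup σ) (Finₚ.punchIn-punchOut l≢a)) σa≡v
  spec : ∀ x → punchIn (suc l) (lookup ρ (punchIn w x)) ≡ lookup σ (punchIn (inject₁ l) (punchIn w x))
  spec x = punchIn-D l σ perm (punchIn w x) λ eq →
    Finₚ.punchInᵢ≢i w x (Finₚ.punchIn-injective (inject₁ l) _ _ (perm _ _ (≡.trans eq (≡.sym σw))))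
  label : ∀ x → c (lookup σ (punchIn (inject₁ l) x)) ≡ c (punchIn (suc l) (lookup ρ x))
  label x with lookup σ (punchIn (inject₁ l) x) ≟ suc l
  ... | yes eq = ≡.trans (cong c eq) (≡.trans cv (cong c (≡.sym (punchIn-D-join l σ perm x eq))))
  ... | no neq = cong c (≡.sym (punchIn-D l σ perm x neq))

-- Double sums over the two-element field

⨁-indicator : ∀ {n} (a : Fin n) (δ f : Fin n → Bool) → δ a ≡ true → (∀ x → x ≢ a → δ x ≡ false) →
  ⨁ (λ x → δ x ∧ f x) ≡ f a
⨁-indicator {suc n} a δ f δa δx = begin
  ⨁ (λ x → δ x ∧ f x)
    ≡⟨ sum-remove {i = a} (λ x → δ x ∧ f x) ⟩
  (δ a ∧ f a) xor ⨁ (λ x → δ (punchIn a x) ∧ f (punchIn a x))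
    ≡⟨ cong₂ _xor_ (cong (_∧ f a) δa) (⨁-zero λ x → cong (_∧ f (punchIn a x)) (δx _ (Finₚ.punchInᵢ≢i a x))) ⟩
  f a xor false
    ≡⟨ Boolₚ.xor-identityʳ (f a) ⟩
  f a ∎
  where open ≡.≡-Reasoning

⨁⨁-product : ∀ {n} (f g : Fin n → Bool) → ⨁ (λ x → ⨁ λ y → f x ∧ g y) ≡ ⨁ f ∧ ⨁ g
⨁⨁-product f g = ≡.trans (sum-cong-≗ λ x → ≡.sym (*-distribˡ-sum (f x) g)) (≡.sym (*-distribʳ-sum (⨁ g) f))

⨁⨁-distrib : ∀ {m n} (f g : Fin m → Fin n → Bool) →
  ⨁ (λ x → ⨁ λ y → f x y xor g x y) ≡ ⨁ (λ x → ⨁ (f x)) xor ⨁ (λ x → ⨁ (g x))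
⨁⨁-distrib f g = ≡.trans (sum-cong-≗ λ x → ∑-distrib-+ (f x) (g x)) (∑-distrib-+ (λ x → ⨁ (f x)) (λ x → ⨁ (g x)))

-- Only the total matters, so one part of the summand may be transposed to meet its mirror image in
-- the other part.
⨁⨁-symmetrise : ∀ {n} (f g : Fin n → Fin n → Bool) →
  ⨁ (λ x → ⨁ λ y → f x y xor g x y) ≡ ⨁ (λ x → ⨁ λ y → f x y xor g y x)
⨁⨁-symmetrise f g = begin
  ⨁ (λ x → ⨁ λ y → f x y xor g x y)              ≡⟨ ⨁⨁-distrib f g ⟩
  ⨁ (λ x → ⨁ (f x)) xor ⨁ (λ x → ⨁ (g x))        ≡⟨ cong (⨁ (λ x → ⨁ (f x)) xor_) (∑-comm g) ⟩
  ⨁ (λ x → ⨁ (f x)) xor ⨁ (λ x → ⨁ λ y → g y x)  ≡⟨ ⨁⨁-distrib f (λ x y → g y x) ⟨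
  ⨁ (λ x → ⨁ λ y → f x y xor g y x)              ∎
  where open ≡.≡-Reasoning

koszul-permute : ∀ {K} (τ τ⁻¹ : Fin K → Fin K) → (∀ x → τ (τ⁻¹ x) ≡ x) → (∀ x → τ⁻¹ (τ x) ≡ x) →
  (s t : Fin K → ℕ) (c : Fin K → Bool) → koszul s t c ≡ koszul (s ∘ τ) (t ∘ τ) (c ∘ τ)
koszul-permute τ τ⁻¹ inverseˡ inverseʳ s t c = ≡.trans
  (sum-permute (λ x → ⨁ (A x)) π) (sum-cong-≗ λ x → sum-permute (A (τ x)) π)
  where
  π = Permutation.permutation τ τ⁻¹ inverseˡ inverseʳ
  A : Fin _ → Fin _ → Bool
  A x y = (c x ∧ c y) ∧ ((s x <ᵇ t y) xor ((s x <ᵇ s y) ∧ (t x <ᵇ t y)))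

<ᵇ-resp : ∀ {a b c d} → (a < b → c < d) → (c < d → a < b) → (a <ᵇ b) ≡ (c <ᵇ d)
<ᵇ-resp {a} {b} {c} {d} f g with a <ᵇ b in ab | c <ᵇ d in cd
... | true | true = ≡.refl
... | false | false = ≡.refl
... | true | false with () ← subst T cd (ℕₚ.<⇒<ᵇ (f (ℕₚ.<ᵇ⇒< a b (subst T (≡.sym ab) _))))
... | false | true with () ← subst T ab (ℕₚ.<⇒<ᵇ (g (ℕₚ.<ᵇ⇒< c d (subst T (≡.sym cd) _))))

-- Conjugation by an adjacent transposition

module _ {k} (l : Fin k) where

  private
    u v : Fin (suc k) → Bool
    u x = does (x ≟ inject₁ l)
    v x = does (x ≟ suc l)

  -- No vertex lies between `l` and `l+1`, so the swap can reverse only their mutual comparison; the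
  -- correction is supported on these two ordered pairs.
  <ᵇ-swapAt : ∀ x y → (toℕ (swapAt l x) <ᵇ toℕ (swapAt l y)) ≡
    (toℕ x <ᵇ toℕ y) xor ((u x ∧ v y) xor (v x ∧ u y))
  <ᵇ-swapAt x y with swapView l x | swapView l y
  ... | lower | lower
    rewrite swapAt-inject₁ l | dec-true (inject₁ l ≟ inject₁ l) ≡.refl | dec-false (inject₁ l ≟ suc l) (inject₁≢suc l)
          | <ᵇ-irrefl (toℕ l) | <ᵇ-irrefl (toℕ (inject₁ l)) = ≡.refl
  ... | lower | upper
    rewrite swapAt-inject₁ l | swapAt-suc l | dec-true (inject₁ l ≟ inject₁ l) ≡.refl | dec-true (suc l ≟ suc l) ≡.refl
          | dec-false (inject₁ l ≟ suc l) (inject₁≢suc l)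
          | Finₚ.toℕ-inject₁ l | <ᵇ-suc (toℕ l) (toℕ l) | <ᵇ-irrefl (toℕ l)
          | <ᵇ-flip (toℕ l) (suc (toℕ l)) (ℕₚ.1+n≢n ∘ ≡.sym) | <ᵇ-suc (toℕ l) (toℕ l) | <ᵇ-irrefl (toℕ l) = ≡.refl
  ... | upper | lower
    rewrite swapAt-inject₁ l | swapAt-suc l | dec-true (inject₁ l ≟ inject₁ l) ≡.refl | dec-true (suc l ≟ suc l) ≡.refl
          | dec-false (inject₁ l ≟ suc l) (inject₁≢suc l) | dec-false (suc l ≟ inject₁ l) (inject₁≢suc l ∘ ≡.sym)
          | Finₚ.toℕ-inject₁ l | <ᵇ-suc (toℕ l) (toℕ l) | <ᵇ-irrefl (toℕ l)
          | <ᵇ-flip (toℕ l) (suc (toℕ l)) (ℕₚ.1+n≢n ∘ ≡.sym) | <ᵇ-suc (toℕ l) (toℕ l) | <ᵇ-irrefl (toℕ l) = ≡.refl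
  ... | upper | upper
    rewrite swapAt-suc l | dec-true (suc l ≟ suc l) ≡.refl | dec-false (suc l ≟ inject₁ l) (inject₁≢suc l ∘ ≡.sym)
          | <ᵇ-irrefl (toℕ l) | <ᵇ-irrefl (toℕ (inject₁ l)) = ≡.refl
  ... | lower | other y≢l y≢v
    rewrite swapAt-inject₁ l | swapAt-other l y y≢l y≢v | dec-false (y ≟ inject₁ l) y≢l | dec-false (y ≟ suc l) y≢v
          | Boolₚ.∧-zeroʳ (u (inject₁ l)) | Boolₚ.∧-zeroʳ (v (inject₁ l)) | Boolₚ.xor-identityʳ (toℕ (inject₁ l) <ᵇ toℕ y)
          | Finₚ.toℕ-inject₁ l = suc-<ᵇ (toℕ l) (toℕ y) (λ eq → y≢v (Finₚ.toℕ-injective eq))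
  ... | upper | other y≢l y≢v
    rewrite swapAt-suc l | swapAt-other l y y≢l y≢v | dec-false (y ≟ inject₁ l) y≢l | dec-false (y ≟ suc l) y≢v
          | Boolₚ.∧-zeroʳ (u (suc l)) | Boolₚ.∧-zeroʳ (v (suc l)) | Boolₚ.xor-identityʳ (suc (toℕ l) <ᵇ toℕ y)
          | Finₚ.toℕ-inject₁ l = ≡.sym (suc-<ᵇ (toℕ l) (toℕ y) (λ eq → y≢v (Finₚ.toℕ-injective eq)))
  ... | other x≢l x≢v | lower
    rewrite swapAt-inject₁ l | swapAt-other l x x≢l x≢v | dec-false (x ≟ inject₁ l) x≢l | dec-false (x ≟ suc l) x≢v
          | Boolₚ.xor-identityʳ (toℕ x <ᵇ toℕ (inject₁ l)) | Finₚ.toℕ-inject₁ l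
          | <ᵇ-suc (toℕ x) (toℕ l)
          = ≡.sym (<ᵇ-flip (toℕ l) (toℕ x) (λ eq → x≢l (Finₚ.toℕ-injective (≡.trans (≡.sym eq) (≡.sym (Finₚ.toℕ-inject₁ l))))))
  ... | other x≢l x≢v | upper
    rewrite swapAt-suc l | swapAt-other l x x≢l x≢v | dec-false (x ≟ inject₁ l) x≢l | dec-false (x ≟ suc l) x≢v
          | Boolₚ.xor-identityʳ (toℕ x <ᵇ suc (toℕ l)) | Finₚ.toℕ-inject₁ l
          | <ᵇ-suc (toℕ x) (toℕ l)
          = <ᵇ-flip (toℕ l) (toℕ x) (λ eq → x≢l (Finₚ.toℕ-injective (≡.trans (≡.sym eq) (≡.sym (Finₚ.toℕ-inject₁ l)))))
  ... | other x≢l x≢v | other y≢l y≢v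
    rewrite swapAt-other l x x≢l x≢v | swapAt-other l y y≢l y≢v
          | dec-false (x ≟ inject₁ l) x≢l | dec-false (x ≟ suc l) x≢v = ≡.sym (Boolₚ.xor-identityʳ _)

  disjoint : ∀ x → u x ∧ v x ≡ false
  disjoint x with swapView l x
  ... | lower rewrite dec-false (inject₁ l ≟ suc l) (inject₁≢suc l) = Boolₚ.∧-zeroʳ _
  ... | upper rewrite dec-false (suc l ≟ inject₁ l) (inject₁≢suc l ∘ ≡.sym) = ≡.refl
  ... | other x≢l x≢v rewrite dec-false (x ≟ inject₁ l) x≢l = ≡.refl

  -- Moving the blocks (in, out) of l and l+1 past each other costs the product of their parities.
  sign-conjτ : (σ : Perm (suc k)) → IsPerm σ → (c : Fin (suc k) → Bool) →
    sign (conjτ l σ) (c ∘ swapAt l) ≡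
    sign σ c xor ((c (inject₁ l) xor c (lookup σ (inject₁ l))) ∧ (c (suc l) xor c (lookup σ (suc l))))
  sign-conjτ σ perm c = begin
    sign (conjτ l σ) (c ∘ τ)
      ≡⟨ koszul-permute τ τ (swapAt-involutive l) (swapAt-involutive l) toℕ (toℕ ∘ lookup (conjτ l σ)) (c ∘ τ ∘ lookup (conjτ l σ)) ⟩
    koszul (toℕ ∘ τ) (toℕ ∘ lookup (conjτ l σ) ∘ τ) (c ∘ τ ∘ lookup (conjτ l σ) ∘ τ)
      ≡⟨ koszul-cong (toℕ ∘ τ) (toℕ ∘ τ) (toℕ ∘ lookup (conjτ l σ) ∘ τ) (toℕ ∘ τ ∘ lookup σ) (c ∘ τ ∘ lookup (conjτ l σ) ∘ τ) e
           (λ x y → cong (λ z → toℕ (τ x) <ᵇ toℕ z) (spec y)) (λ _ _ → ≡.refl)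
           (λ x y → cong₂ (λ z w → toℕ z <ᵇ toℕ w) (spec x) (spec y))
           (λ x → cong c (≡.trans (cong τ (spec x)) (swapAt-involutive l _))) ⟩
    koszul (toℕ ∘ τ) (toℕ ∘ τ ∘ lookup σ) e
      ≡⟨ (sum-cong-≗ λ x → sum-cong-≗ λ y → ≡.trans
            (cong (λ z → (e x ∧ e y) ∧ z) (cong₂ _xor_ (<ᵇ-swapAt x (lookup σ y))
              (cong₂ _∧_ (<ᵇ-swapAt x y) (<ᵇ-swapAt (lookup σ x) (lookup σ y)))))
            (expand x y)) ⟩
    ⨁ (λ x → ⨁ λ y → A x y xor B x y)
      -- `B` holds the corrections of the comparison products on the mirrored supports. Transposing
      -- it puts them on the supports used in `A`, where `q x y` meets `q y x` and `p x y` meets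
      -- `p y x`.
      ≡⟨ ⨁⨁-symmetrise A B ⟩
    ⨁ (λ x → ⨁ λ y → A x y xor B y x)
      ≡⟨ (sum-cong-≗ λ x → sum-cong-≗ λ y → collect x y) ⟩
    ⨁ (λ x → ⨁ λ y → O x y xor (X x y xor Y x y))
      ≡⟨ ≡.trans (⨁⨁-distrib O (λ x y → X x y xor Y x y)) (cong (sign σ c xor_)
           (≡.trans (⨁⨁-distrib X Y)
             (cong₂ _xor_ (⨁⨁-distrib (λ x y → f x ∧ g′ y) (λ x y → g x ∧ f′ y))
                          (⨁⨁-distrib (λ x y → f x ∧ g y) (λ x y → f′ x ∧ g′ y))))) ⟩
    sign σ c xor ((⨁ (λ x → ⨁ λ y → f x ∧ g′ y) xor ⨁ (λ x → ⨁ λ y → g x ∧ f′ y)) xor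
                  (⨁ (λ x → ⨁ λ y → f x ∧ g y) xor ⨁ (λ x → ⨁ λ y → f′ x ∧ g′ y)))
      -- Each double sum is a product of two single sums, and in each of these one index survives,
      -- giving the parity of the edge that leaves or enters `l` or `l+1`.
      ≡⟨ cong (sign σ c xor_) (cong₂ _xor_
           (cong₂ _xor_ (product f g′ Σf Σg′) (product g f′ Σg Σf′))
           (cong₂ _xor_ (product f g Σf Σg) (product f′ g′ Σf′ Σg′))) ⟩
    sign σ c xor (((cσl ∧ cv) xor (cσv ∧ cl)) xor ((cσl ∧ cσv) xor (cl ∧ cv)))
      ≡⟨ cong (sign σ c xor_) (tautology 4
           (λ cl cv cσl cσv → ((cσl ∧ cv) xor (cσv ∧ cl)) xor ((cσl ∧ cσv) xor (cl ∧ cv)))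
           (λ cl cv cσl cσv → (cl xor cσl) ∧ (cv xor cσv)) cl cv cσl cσv) ⟩
    sign σ c xor ((cl xor cσl) ∧ (cv xor cσv)) ∎
    where
    open ≡.≡-Reasoning
    τ = swapAt l
    e = c ∘ lookup σ
    cl = c (inject₁ l)
    cv = c (suc l)
    cσl = c (lookup σ (inject₁ l))
    cσv = c (lookup σ (suc l))
    u′ = u ∘ lookup σ
    v′ = v ∘ lookup σ
    f g f′ g′ : Fin (suc k) → Bool
    f x = u x ∧ e x
    g x = v x ∧ e x
    f′ x = u′ x ∧ e x
    g′ x = v′ x ∧ e x
    p q : Fin (suc k) → Fin (suc k) → Bool
    p x y = toℕ x <ᵇ toℕ y
    q x y = toℕ (lookup σ x) <ᵇ toℕ (lookup σ y)
    X Y O A B : Fin (suc k) → Fin (suc k) → Bool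
    X x y = (f x ∧ g′ y) xor (g x ∧ f′ y)
    Y x y = (f x ∧ g y) xor (f′ x ∧ g′ y)
    O x y = (e x ∧ e y) ∧ ((toℕ x <ᵇ toℕ (lookup σ y)) xor (p x y ∧ q x y))
    A x y = (O x y xor ((e x ∧ e y) ∧ ((u x ∧ v′ y) xor (v x ∧ u′ y)))) xor
      ((e x ∧ e y) ∧ (((u x ∧ v y) ∧ (q x y xor ((u′ x ∧ v′ y) xor (v′ x ∧ u′ y)))) xor (p x y ∧ (u′ x ∧ v′ y))))
    B x y = (e x ∧ e y) ∧ (((v x ∧ u y) ∧ (q x y xor ((u′ x ∧ v′ y) xor (v′ x ∧ u′ y)))) xor (p x y ∧ (v′ x ∧ u′ y)))
    spec : ∀ x → lookup (conjτ l σ) (τ x) ≡ τ (lookup σ x)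
    spec x = ≡.trans (lookup-conjτ l σ (τ x)) (cong (τ ∘ lookup σ) (swapAt-involutive l x))
    expand : ∀ x y →
      (e x ∧ e y) ∧ (((toℕ x <ᵇ toℕ (lookup σ y)) xor ((u x ∧ v′ y) xor (v x ∧ u′ y))) xor
        ((p x y xor ((u x ∧ v y) xor (v x ∧ u y))) ∧ (q x y xor ((u′ x ∧ v′ y) xor (v′ x ∧ u′ y)))))
      ≡ A x y xor B x y
    expand x y = tautology 9
      (λ ee r pp qq a b a′ b′ d →
        ee ∧ ((r xor d) xor ((pp xor (a xor b)) ∧ (qq xor (a′ xor b′)))))
      (λ ee r pp qq a b a′ b′ d →
        (((ee ∧ (r xor (pp ∧ qq))) xor (ee ∧ d)) xor
          (ee ∧ ((a ∧ (qq xor (a′ xor b′))) xor (pp ∧ a′)))) xor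
        (ee ∧ ((b ∧ (qq xor (a′ xor b′))) xor (pp ∧ b′))))
      (e x ∧ e y) (toℕ x <ᵇ toℕ (lookup σ y)) (p x y) (q x y) (u x ∧ v y) (v x ∧ u y)
      (u′ x ∧ v′ y) (v′ x ∧ u′ y) ((u x ∧ v′ y) xor (v x ∧ u′ y))
    -- For `x ≠ y` the two opposite comparisons add up to 1; for `x = y` both sides vanish, since no
    -- vertex is both `l` and `l+1`.
    split-q : ∀ x y → (u x ∧ v y) ∧ (q x y xor q y x) ≡ u x ∧ v y
    split-q x y with x ≟ y
    ... | yes ≡.refl = ≡.trans (cong (_∧ (q x y xor q y x)) (disjoint x)) (≡.sym (disjoint x))
    ... | no x≢y rewrite <ᵇ-flip (toℕ (lookup σ x)) (toℕ (lookup σ y)) (λ eq → x≢y (perm x y (Finₚ.toℕ-injective eq))) =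
      tautology 2 (λ a b → a ∧ (b xor not b)) (λ a b → a) (u x ∧ v y) (q x y)
    split-p : ∀ x y → (u′ x ∧ v′ y) ∧ (p x y xor p y x) ≡ u′ x ∧ v′ y
    split-p x y with x ≟ y
    ... | yes ≡.refl = ≡.trans (cong (_∧ (p x y xor p y x)) (disjoint (lookup σ x))) (≡.sym (disjoint (lookup σ x)))
    ... | no x≢y rewrite <ᵇ-flip (toℕ x) (toℕ y) (λ eq → x≢y (Finₚ.toℕ-injective eq)) =
      tautology 2 (λ a b → a ∧ (b xor not b)) (λ a b → a) (u′ x ∧ v′ y) (p x y)
    collect : ∀ x y → A x y xor B y x ≡
      O x y xor (X x y xor Y x y)
    collect x y = begin
      A x y xor B y x
        ≡⟨ cong (A x y xor_) (cong₂ _∧_ (Boolₚ.∧-comm (e y) (e x)) (cong₂ _xor_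
             (cong₂ _∧_ (Boolₚ.∧-comm (v y) (u x)) (cong (q y x xor_)
               (≡.trans (cong₂ _xor_ (Boolₚ.∧-comm (u′ y) (v′ x)) (Boolₚ.∧-comm (v′ y) (u′ x))) (Boolₚ.xor-comm _ (u′ x ∧ v′ y)))))
             (cong (p y x ∧_) (Boolₚ.∧-comm (v′ y) (u′ x))))) ⟩
      A x y xor ((e x ∧ e y) ∧ (((u x ∧ v y) ∧ (q y x xor s)) xor (p y x ∧ (u′ x ∧ v′ y))))
        ≡⟨ tautology 10
             (λ o ee d a qq ss pp a′ qq′ pp′ →
               ((o xor (ee ∧ d)) xor (ee ∧ ((a ∧ (qq xor ss)) xor (pp ∧ a′)))) xor
               (ee ∧ ((a ∧ (qq′ xor ss)) xor (pp′ ∧ a′))))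
             (λ o ee d a qq ss pp a′ qq′ pp′ →
               o xor ((ee ∧ d) xor (ee ∧ ((a ∧ (qq xor qq′)) xor (a′ ∧ (pp xor pp′))))))
             (O x y) (e x ∧ e y) ((u x ∧ v′ y) xor (v x ∧ u′ y)) (u x ∧ v y) (q x y) s (p x y)
             (u′ x ∧ v′ y) (q y x) (p y x) ⟩
      O x y xor (((e x ∧ e y) ∧ ((u x ∧ v′ y) xor (v x ∧ u′ y))) xor
        ((e x ∧ e y) ∧ (((u x ∧ v y) ∧ (q x y xor q y x)) xor ((u′ x ∧ v′ y) ∧ (p x y xor p y x)))))
        ≡⟨ cong (λ z → O x y xor (((e x ∧ e y) ∧ ((u x ∧ v′ y) xor (v x ∧ u′ y))) xor ((e x ∧ e y) ∧ z)))
             (cong₂ _xor_ (split-q x y) (split-p x y)) ⟩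
      O x y xor (((e x ∧ e y) ∧ ((u x ∧ v′ y) xor (v x ∧ u′ y))) xor
        ((e x ∧ e y) ∧ ((u x ∧ v y) xor (u′ x ∧ v′ y))))
        ≡⟨ cong (O x y xor_) (cong₂ _xor_ (distribute (u x) (v′ y) (v x) (u′ y)) (distribute (u x) (v y) (u′ x) (v′ y))) ⟩
      O x y xor (X x y xor Y x y) ∎
      where
      s = (u′ x ∧ v′ y) xor (v′ x ∧ u′ y)
      distribute : ∀ a b a′ b′ →
        (e x ∧ e y) ∧ ((a ∧ b) xor (a′ ∧ b′)) ≡ ((a ∧ e x) ∧ (b ∧ e y)) xor ((a′ ∧ e x) ∧ (b′ ∧ e y))
      distribute = tautology 6 (λ ex ey a b a′ b′ → (ex ∧ ey) ∧ ((a ∧ b) xor (a′ ∧ b′)))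
        (λ ex ey a b a′ b′ → ((a ∧ ex) ∧ (b ∧ ey)) xor ((a′ ∧ ex) ∧ (b′ ∧ ey))) (e x) (e y)
    product : ∀ (f g : Fin (suc k) → Bool) {a b} → ⨁ f ≡ a → ⨁ g ≡ b → ⨁ (λ x → ⨁ λ y → f x ∧ g y) ≡ a ∧ b
    product f g Σf Σg = ≡.trans (⨁⨁-product f g) (cong₂ _∧_ Σf Σg)
    Σf : ⨁ f ≡ cσl
    Σf = ⨁-indicator (inject₁ l) u e (dec-true (inject₁ l ≟ inject₁ l) ≡.refl) (λ x → dec-false (x ≟ _))
    Σg : ⨁ g ≡ cσv
    Σg = ⨁-indicator (suc l) v e (dec-true (suc l ≟ suc l) ≡.refl) (λ x → dec-false (x ≟ _))
    at : ∀ y → ⨁ (λ x → does (lookup σ x ≟ y) ∧ e x) ≡ c y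
    at y with preimage σ perm y
    ... | a , σa≡y = ≡.trans
      (⨁-indicator a (λ x → does (lookup σ x ≟ y)) e (dec-true (_ ≟ _) σa≡y)
        (λ x x≢a → dec-false (_ ≟ _) λ eq → x≢a (perm x a (≡.trans eq (≡.sym σa≡y)))))
      (cong c σa≡y)
    Σf′ : ⨁ f′ ≡ cl
    Σf′ = at (inject₁ l)
    Σg′ : ⨁ g′ ≡ cv
    Σg′ = at (suc l)

-- Concatenations and cycles

⨁-++ : ∀ k {j} (f : Fin (k ℕ.+ j) → Bool) → ⨁ f ≡ ⨁ (f ∘ (_↑ˡ j)) xor ⨁ (f ∘ (k ↑ʳ_))
⨁-++ zero f = ≡.refl
⨁-++ (suc k) f = ≡.trans (cong (f zero xor_) (⨁-++ k (f ∘ suc))) (≡.sym (Boolₚ.xor-assoc (f zero) _ _))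

lookup-⊔ₚˡ : ∀ {k j} (σ : Perm k) (ρ : Perm j) x → lookup (σ ⊔ₚ ρ) (x ↑ˡ j) ≡ lookup σ x ↑ˡ j
lookup-⊔ₚˡ {k} {j} σ ρ x = ≡.trans (Vecₚ.lookup∘tabulate
    (λ x → [ (λ a → lookup σ a ↑ˡ j) , (λ b → k ↑ʳ lookup ρ b) ]′ (splitAt k x)) (x ↑ˡ j))
  (cong [ (λ a → lookup σ a ↑ˡ j) , (λ b → k ↑ʳ lookup ρ b) ]′ (Finₚ.splitAt-↑ˡ k x j))

lookup-⊔ₚʳ : ∀ {k j} (σ : Perm k) (ρ : Perm j) y → lookup (σ ⊔ₚ ρ) (k ↑ʳ y) ≡ k ↑ʳ lookup ρ y
lookup-⊔ₚʳ {k} {j} σ ρ y = ≡.trans (Vecₚ.lookup∘tabulate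
    (λ x → [ (λ a → lookup σ a ↑ˡ j) , (λ b → k ↑ʳ lookup ρ b) ]′ (splitAt k x)) (k ↑ʳ y))
  (cong [ (λ a → lookup σ a ↑ˡ j) , (λ b → k ↑ʳ lookup ρ b) ]′ (Finₚ.splitAt-↑ʳ k j y))

left<ᵇright : ∀ {k} j (x : Fin k) (y : Fin j) → (toℕ (x ↑ˡ j) <ᵇ toℕ (k ↑ʳ y)) ≡ true
left<ᵇright j zero y = ≡.refl
left<ᵇright j (suc x) y = left<ᵇright j x y

right<ᵇleft : ∀ {k} j (x : Fin k) (y : Fin j) → (toℕ (k ↑ʳ y) <ᵇ toℕ (x ↑ˡ j)) ≡ false
right<ᵇleft j zero y = ≡.refl
right<ᵇleft j (suc x) y = right<ᵇleft j x y

left<ᵇleft : ∀ {k} j (x y : Fin k) → (toℕ (x ↑ˡ j) <ᵇ toℕ (y ↑ˡ j)) ≡ (toℕ x <ᵇ toℕ y)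
left<ᵇleft j x y rewrite Finₚ.toℕ-↑ˡ x j | Finₚ.toℕ-↑ˡ y j = ≡.refl

right<ᵇright : ∀ k {j} (x y : Fin j) → (toℕ (k ↑ʳ x) <ᵇ toℕ (k ↑ʳ y)) ≡ (toℕ x <ᵇ toℕ y)
right<ᵇright zero x y = ≡.refl
right<ᵇright (suc k) x y = right<ᵇright k x y

-- Mixed terms vanish one by one: from the left block to the right one both parts of the kernel are
-- 1 and cancel, and in the other order both are 0.
sign-⊔ₚ : ∀ {k j} (σ : Perm k) (ρ : Perm j) (c : Fin (k ℕ.+ j) → Bool) →
  sign (σ ⊔ₚ ρ) c ≡ sign σ (c ∘ (_↑ˡ j)) xor sign ρ (c ∘ (k ↑ʳ_))
sign-⊔ₚ {k} {j} σ ρ c = begin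
  sign (σ ⊔ₚ ρ) c
    ≡⟨ ≡.trans (⨁-++ k (λ x → ⨁ (A x)))
         (cong₂ _xor_ (sum-cong-≗ λ x → ⨁-++ k (A (x ↑ˡ j))) (sum-cong-≗ λ x → ⨁-++ k (A (k ↑ʳ x)))) ⟩
  ⨁ (λ x → ⨁ (λ y → A (x ↑ˡ j) (y ↑ˡ j)) xor ⨁ (λ y → A (x ↑ˡ j) (k ↑ʳ y))) xor
  ⨁ (λ x → ⨁ (λ y → A (k ↑ʳ x) (y ↑ˡ j)) xor ⨁ (λ y → A (k ↑ʳ x) (k ↑ʳ y)))
    ≡⟨ cong₂ _xor_
         (sum-cong-≗ λ x → ≡.trans
           (cong₂ _xor_ (sum-cong-≗ λ y → ll x y) (⨁-zero λ y → lr x y)) (Boolₚ.xor-identityʳ _))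
         (sum-cong-≗ λ x →
           cong₂ _xor_ (⨁-zero λ y → rl x y) (sum-cong-≗ λ y → rr x y)) ⟩
  sign σ (c ∘ (_↑ˡ j)) xor sign ρ (c ∘ (k ↑ʳ_)) ∎
  where
  open ≡.≡-Reasoning
  π = lookup (σ ⊔ₚ ρ)
  A : Fin (k ℕ.+ j) → Fin (k ℕ.+ j) → Bool
  A x y = (c (π x) ∧ c (π y)) ∧ ((toℕ x <ᵇ toℕ (π y)) xor ((toℕ x <ᵇ toℕ y) ∧ (toℕ (π x) <ᵇ toℕ (π y))))
  ll : ∀ x y → A (x ↑ˡ j) (y ↑ˡ j) ≡ _
  ll x y rewrite lookup-⊔ₚˡ σ ρ x | lookup-⊔ₚˡ σ ρ y | left<ᵇleft j x (lookup σ y) | left<ᵇleft j x y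
    | left<ᵇleft j (lookup σ x) (lookup σ y) = ≡.refl
  rr : ∀ x y → A (k ↑ʳ x) (k ↑ʳ y) ≡ _
  rr x y rewrite lookup-⊔ₚʳ σ ρ x | lookup-⊔ₚʳ σ ρ y | right<ᵇright k x (lookup ρ y) | right<ᵇright k x y
    | right<ᵇright k (lookup ρ x) (lookup ρ y) = ≡.refl
  lr : ∀ x y → A (x ↑ˡ j) (k ↑ʳ y) ≡ false
  lr x y rewrite lookup-⊔ₚˡ σ ρ x | lookup-⊔ₚʳ σ ρ y | left<ᵇright j x (lookup ρ y) | left<ᵇright j x y
    | left<ᵇright j (lookup σ x) (lookup ρ y) = Boolₚ.∧-zeroʳ _
  rl : ∀ x y → A (k ↑ʳ x) (y ↑ˡ j) ≡ false
  rl x y rewrite lookup-⊔ₚʳ σ ρ x | lookup-⊔ₚˡ σ ρ y | right<ᵇleft j (lookup σ y) x | right<ᵇleft j y x = Boolₚ.∧-zeroʳ _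

sucOrZero-punchIn : ∀ {k} (x : Fin (suc k)) → sucOrZero x ≡ punchIn (suc zero) x
sucOrZero-punchIn zero = ≡.refl
sucOrZero-punchIn (suc x) = ≡.refl

cyc-injective : ∀ {k} (x y : Fin (suc k)) → cyc x ≡ cyc y → x ≡ y
cyc-injective {zero} zero zero _ = ≡.refl
cyc-injective {suc k} zero zero _ = ≡.refl
cyc-injective {suc k} zero (suc y) eq =
  contradiction (≡.sym (≡.trans eq (sucOrZero-punchIn (cyc y)))) (Finₚ.punchInᵢ≢i (suc zero) (cyc y))
cyc-injective {suc k} (suc x) zero eq =
  contradiction (≡.trans (≡.sym (sucOrZero-punchIn (cyc x))) eq) (Finₚ.punchInᵢ≢i (suc zero) (cyc x))
cyc-injective {suc k} (suc x) (suc y) eq = cong suc (cyc-injective x y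
  (Finₚ.punchIn-injective (suc zero) (cyc x) (cyc y)
    (≡.trans (≡.sym (sucOrZero-punchIn (cyc x))) (≡.trans eq (sucOrZero-punchIn (cyc y))))))

lookup-cyclePerm : ∀ k x → lookup (cyclePerm k) x ≡ cyc x
lookup-cyclePerm k = Vecₚ.lookup∘tabulate cyc

IsPerm-cyclePerm : ∀ k → IsPerm (cyclePerm k)
IsPerm-cyclePerm k x y eq =
  cyc-injective x y (≡.trans (≡.sym (lookup-cyclePerm k x)) (≡.trans eq (lookup-cyclePerm k y)))

D-cyclePerm : ∀ k → D zero (cyclePerm (suc k)) ≡ cyclePerm k
D-cyclePerm k = Perm-ext λ x → Finₚ.punchIn-injective (suc zero) _ _ (begin
  punchIn (suc zero) (lookup (D zero (cyclePerm (suc k))) x)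
    ≡⟨ punchIn-D-step zero (cyclePerm (suc k)) (IsPerm-cyclePerm (suc k)) x ≡.refl ⟩
  lookup (cyclePerm (suc k)) (suc x)      ≡⟨ lookup-cyclePerm (suc k) (suc x) ⟩
  sucOrZero (cyc x)                       ≡⟨ sucOrZero-punchIn (cyc x) ⟩
  punchIn (suc zero) (cyc x)              ≡⟨ cong (punchIn (suc zero)) (lookup-cyclePerm k x) ⟨
  punchIn (suc zero) (lookup (cyclePerm k) x) ∎)
  where open ≡.≡-Reasoning

-- Contracting the first edge costs its parity and leaves the shorter standard cycle; the last
-- remaining edge, the one entering vertex 0, is a loop and costs nothing.
sign-cyclePerm : ∀ k (c : Fin (suc k) → Bool) → sign (cyclePerm k) c ≡ ⨁ (λ t → c (suc t))
sign-cyclePerm zero c = tautology 1 (λ a → (((a ∧ a) ∧ false) xor false) xor false) (λ _ → false) (c zero)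
sign-cyclePerm (suc k) c = begin
  sign (cyclePerm (suc k)) c
    ≡⟨ sign-step zero (cyclePerm (suc k)) (IsPerm-cyclePerm (suc k)) ≡.refl c ⟩
  c (suc zero) xor sign (D zero (cyclePerm (suc k))) (c ∘ punchIn (suc zero))
    ≡⟨ cong (λ ρ → c (suc zero) xor sign ρ (c ∘ punchIn (suc zero))) (D-cyclePerm k) ⟩
  c (suc zero) xor sign (cyclePerm k) (c ∘ punchIn (suc zero))
    ≡⟨ cong (c (suc zero) xor_) (sign-cyclePerm k (c ∘ punchIn (suc zero))) ⟩
  ⨁ (λ t → c (suc t)) ∎
  where open ≡.≡-Reasoning

-- The sign function of the digraph

foldr-allFin : ∀ {a b} {A : Set a} {B : Set b} (_∙_ : A → B → B) e {n k} (f : Fin n → A) (g : Fin k → Fin n) →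
  List.foldr (λ x acc → f x ∙ acc) e (List.tabulate g) ≡ Vector.foldr _∙_ e (f ∘ g)
foldr-allFin _∙_ e {k = zero} f g = ≡.refl
foldr-allFin _∙_ e {k = suc k} f g = cong (f (g zero) ∙_) (foldr-allFin _∙_ e f (g ∘ suc))

-- Entries below the diagonal are transposed onto the entries above it, which passes from ordered
-- pairs to the unordered pairs in the definition of `fσ`.
⨁-triangle : ∀ {n} (A : Fin n → Fin n → Bool) →
  ⨁ (λ x → ⨁ (A x)) ≡ ⨁ (λ x → A x x) xor ⨁ (λ x → ⨁ λ y → (toℕ x <ᵇ toℕ y) ∧ (A x y xor A y x))
⨁-triangle A = begin
  ⨁ (λ x → ⨁ (A x))
    ≡⟨ (sum-cong-≗ λ x → sum-cong-≗ λ y → split x y) ⟩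
  ⨁ (λ x → ⨁ λ y → (does (y ≟ x) ∧ A x y) xor (((x <ₐ y) ∧ A x y) xor ((y <ₐ x) ∧ A x y)))
    ≡⟨ ⨁⨁-distrib (λ x y → does (y ≟ x) ∧ A x y) (λ x y → ((x <ₐ y) ∧ A x y) xor ((y <ₐ x) ∧ A x y)) ⟩
  ⨁ (λ x → ⨁ λ y → does (y ≟ x) ∧ A x y) xor ⨁ (λ x → ⨁ λ y → ((x <ₐ y) ∧ A x y) xor ((y <ₐ x) ∧ A x y))
    ≡⟨ cong₂ _xor_
         (sum-cong-≗ λ x → ⨁-indicator x (λ y → does (y ≟ x)) (A x) (dec-true (x ≟ x) ≡.refl) (λ y → dec-false (y ≟ x)))
         (≡.trans (⨁⨁-symmetrise (λ x y → (x <ₐ y) ∧ A x y) (λ x y → (y <ₐ x) ∧ A x y))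
           (sum-cong-≗ λ x → sum-cong-≗ λ y → ≡.sym (Boolₚ.∧-distribˡ-xor (x <ₐ y) (A x y) (A y x)))) ⟩
  ⨁ (λ x → A x x) xor ⨁ (λ x → ⨁ λ y → (x <ₐ y) ∧ (A x y xor A y x)) ∎
  where
  open ≡.≡-Reasoning
  _<ₐ_ : Fin _ → Fin _ → Bool
  x <ₐ y = toℕ x <ᵇ toℕ y
  split : ∀ x y → A x y ≡ (does (y ≟ x) ∧ A x y) xor (((x <ₐ y) ∧ A x y) xor ((y <ₐ x) ∧ A x y))
  split x y with y ≟ x
  ... | yes ≡.refl rewrite <ᵇ-irrefl (toℕ x) = ≡.sym (Boolₚ.xor-identityʳ (A x x))
  ... | no y≢x rewrite <ᵇ-flip (toℕ x) (toℕ y) (λ eq → y≢x (≡.sym (Finₚ.toℕ-injective eq))) =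
    tautology 2 (λ a b → b) (λ a b → (a ∧ b) xor (not a ∧ b)) (x <ₐ y) (A x y)

-- Offsets 2 and 1 stand for `+1/3` and `-1/3`. At a common vertex the end precedes the start, so
-- `a ≡ b` falls on the false side, as strict comparison of vertices demands.
start<ᵇend : ∀ a b → (3 ℕ.* a ℕ.+ 2 <ᵇ 3 ℕ.* b ℕ.+ 1) ≡ (a <ᵇ b)
start<ᵇend a b = <ᵇ-resp {3 ℕ.* a ℕ.+ 2} {3 ℕ.* b ℕ.+ 1} {a} {b} to from
  where
  to : 3 ℕ.* a ℕ.+ 2 < 3 ℕ.* b ℕ.+ 1 → a < b
  to lt = ℕₚ.*-cancelˡ-< 3 a b (ℕₚ.+-cancelʳ-< 1 (3 ℕ.* a) (3 ℕ.* b)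
    (ℕₚ.<-trans (ℕₚ.+-monoʳ-< (3 ℕ.* a) (ℕₚ.n<1+n 1)) lt))
  from : a < b → 3 ℕ.* a ℕ.+ 2 < 3 ℕ.* b ℕ.+ 1
  from lt = ℕₚ.<-≤-trans (ℕₚ.≤-reflexive (≡.trans (≡.sym (ℕₚ.+-suc (3 ℕ.* a) 2)) (≡.trans (ℕₚ.+-comm (3 ℕ.* a) 3) (≡.sym (ℕₚ.*-suc 3 a)))))
    (ℕₚ.≤-trans (ℕₚ.*-monoʳ-≤ 3 lt) (ℕₚ.m≤m+n (3 ℕ.* b) 1))

scale<ᵇ : ∀ r a b → (3 ℕ.* a ℕ.+ r <ᵇ 3 ℕ.* b ℕ.+ r) ≡ (a <ᵇ b)
scale<ᵇ r a b = <ᵇ-resp {3 ℕ.* a ℕ.+ r} {3 ℕ.* b ℕ.+ r} {a} {b}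
  (λ lt → ℕₚ.*-cancelˡ-< 3 a b (ℕₚ.+-cancelʳ-< r (3 ℕ.* a) (3 ℕ.* b) lt))
  (λ lt → ℕₚ.+-monoˡ-< r (ℕₚ.*-monoʳ-< 3 lt))

start≢end : ∀ a b → 3 ℕ.* a ℕ.+ 2 ≢ 3 ℕ.* b ℕ.+ 1
start≢end a b eq with a ℕₚ.<? b
... | yes a<b = ℕₚ.<-irrefl eq (ℕₚ.<ᵇ⇒< _ _ (subst T (≡.sym (start<ᵇend a b)) (ℕₚ.<⇒<ᵇ a<b)))
... | no a≮b = ℕₚ.<-irrefl (≡.sym eq)
  (ℕₚ.≤-<-trans (ℕₚ.+-monoˡ-≤ 1 (ℕₚ.*-monoʳ-≤ 3 (ℕₚ.≮⇒≥ a≮b))) (ℕₚ.+-monoʳ-< (3 ℕ.* a) (ℕₚ.n<1+n 1)))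

module _ {r ℓ} (R : Ring r ℓ) (m n : ℕ)
         (E : Fin (m ℕ.+ n) → Fin (m ℕ.+ n) → Ring.Carrier R) where

  open GlMN R m n E

  xorL-++ : ∀ xs ys → xorL (xs List.++ ys) ≡ xorL xs xor xorL ys
  xorL-++ List.[] ys = ≡.refl
  xorL-++ (x List.∷ xs) ys = ≡.trans (cong (x xor_) (xorL-++ xs ys)) (≡.sym (Boolₚ.xor-assoc x _ _))

  xorL-map : ∀ {k} (f : Fin k → Bool) → xorL (List.map f (List.allFin k)) ≡ ⨁ f
  xorL-map f = ≡.trans (cong xorL (Listₚ.map-tabulate id f)) (foldr-tabulate f)
    where
    foldr-tabulate : ∀ {k} (f : Fin k → Bool) → xorL (List.tabulate f) ≡ ⨁ f
    foldr-tabulate {zero} f = ≡.refl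
    foldr-tabulate {suc k} f = cong (f zero xor_) (foldr-tabulate (f ∘ suc))

  xorL-concatMap : ∀ {k l} (f : Fin l → List.List Bool) (g : Fin k → Fin l) →
    xorL (List.concatMap f (List.tabulate g)) ≡ ⨁ (xorL ∘ f ∘ g)
  xorL-concatMap {zero} f g = ≡.refl
  xorL-concatMap {suc k} f g = ≡.trans (xorL-++ (f (g zero)) _)
    (cong (xorL (f (g zero)) xor_) (xorL-concatMap f (g ∘ suc)))

  between-xor : ∀ q a b → a ≢ q → b ≢ q → between q a b ≡ (a <ᵇ q) xor (b <ᵇ q)
  between-xor q a b a≢q b≢q rewrite <ᵇ-flip a q a≢q | <ᵇ-flip b q b≢q =
    tautology 2 (λ A B → (A ∧ not B) ∨ (B ∧ not A)) _xor_ (a <ᵇ q) (b <ᵇ q)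

  -- A point lies between two others exactly when an odd number of them is below it. This needs the
  -- endpoints to be distinct: starts from starts since `x ≢ y`, ends from ends by injectivity of
  -- `σ`, and starts from ends by their offsets.
  alternate-xor : ∀ {k} (σ : Perm k) → IsPerm σ → ∀ x y → x ≢ y →
    alternate σ x y ≡ ((toℕ x <ᵇ toℕ y) xor not (toℕ y <ᵇ toℕ (lookup σ x))) xor
                      ((toℕ x <ᵇ toℕ (lookup σ y)) xor (toℕ (lookup σ x) <ᵇ toℕ (lookup σ y)))
  alternate-xor σ perm x y x≢y = cong₂ _xor_
    (≡.trans (between-xor (startP σ y) (startP σ x) (endP σ x)
        (λ eq → x≢y (Finₚ.toℕ-injective (ℕₚ.*-cancelˡ-≡ _ _ 3 (ℕₚ.+-cancelʳ-≡ 2 _ _ eq))))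
        (start≢end (toℕ y) (toℕ (lookup σ x)) ∘ ≡.sym))
      (cong₂ _xor_ (scale<ᵇ 2 (toℕ x) (toℕ y))
        (≡.trans (<ᵇ-flip (startP σ y) (endP σ x) (start≢end (toℕ y) (toℕ (lookup σ x))))
          (cong not (start<ᵇend (toℕ y) (toℕ (lookup σ x)))))))
    (≡.trans (between-xor (endP σ y) (startP σ x) (endP σ x) (start≢end (toℕ x) (toℕ (lookup σ y)))
        (λ eq → x≢y (perm x y (Finₚ.toℕ-injective (ℕₚ.*-cancelˡ-≡ _ _ 3 (ℕₚ.+-cancelʳ-≡ 1 _ _ eq))))))
      (cong₂ _xor_ (start<ᵇend (toℕ x) (toℕ (lookup σ y))) (scale<ᵇ 1 (toℕ (lookup σ x)) (toℕ (lookup σ y)))))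

  fσ-sign : ∀ {k} (σ : Perm k) → IsPerm σ → (i : Fin k → Fin N) → fσ σ i ≡ sign σ (par ∘ i)
  fσ-sign {k} σ perm i = begin
    fσ σ i
      ≡⟨ cong₂ _xor_ (xorL-map (λ x → distinguished σ x ∧ e x))
           (≡.trans (xorL-concatMap (λ x → List.map (λ y → (toℕ x <ᵇ toℕ y) ∧ alternate σ x y ∧ e x ∧ e y) (List.allFin k)) id)
             (sum-cong-≗ λ x → xorL-map (λ y → (toℕ x <ᵇ toℕ y) ∧ alternate σ x y ∧ e x ∧ e y))) ⟩
    ⨁ (λ x → distinguished σ x ∧ e x) xor ⨁ (λ x → ⨁ λ y → (toℕ x <ᵇ toℕ y) ∧ alternate σ x y ∧ e x ∧ e y)
      ≡⟨ cong₂ _xor_ (sum-cong-≗ diagonal) (sum-cong-≗ λ x → sum-cong-≗ λ y → pair x y) ⟨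
    ⨁ (λ x → A x x) xor ⨁ (λ x → ⨁ λ y → (toℕ x <ᵇ toℕ y) ∧ (A x y xor A y x))
      ≡⟨ ⨁-triangle A ⟨
    sign σ (par ∘ i) ∎
    where
    open ≡.≡-Reasoning
    e : Fin k → Bool
    e = par ∘ i ∘ lookup σ
    A : Fin k → Fin k → Bool
    A x y = (e x ∧ e y) ∧ ((toℕ x <ᵇ toℕ (lookup σ y)) xor ((toℕ x <ᵇ toℕ y) ∧ (toℕ (lookup σ x) <ᵇ toℕ (lookup σ y))))
    diagonal : ∀ x → A x x ≡ distinguished σ x ∧ e x
    diagonal x rewrite <ᵇ-irrefl (toℕ x) =
      tautology 2 (λ a b → (a ∧ a) ∧ (b xor false)) (λ a b → b ∧ a) (e x) (toℕ x <ᵇ toℕ (lookup σ x))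
    pair : ∀ x y → (toℕ x <ᵇ toℕ y) ∧ (A x y xor A y x) ≡ (toℕ x <ᵇ toℕ y) ∧ alternate σ x y ∧ e x ∧ e y
    pair x y with x ≟ y
    ... | yes ≡.refl rewrite <ᵇ-irrefl (toℕ x) = ≡.refl
    ... | no x≢y rewrite alternate-xor σ perm x y x≢y
                       | <ᵇ-flip (toℕ x) (toℕ y) (λ eq → x≢y (Finₚ.toℕ-injective eq)) =
      tautology 7
        (λ a b p r r′ q q′ → p ∧ (((a ∧ b) ∧ (r xor (p ∧ q))) xor ((b ∧ a) ∧ (r′ xor (not p ∧ q′)))))
        (λ a b p r r′ q q′ → p ∧ (((p xor not r′) xor (r xor q)) ∧ a ∧ b))
        (e x) (e y) (toℕ x <ᵇ toℕ y) (toℕ x <ᵇ toℕ (lookup σ y)) (toℕ y <ᵇ toℕ (lookup σ x))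
        (toℕ (lookup σ x) <ᵇ toℕ (lookup σ y)) (toℕ (lookup σ y) <ᵇ toℕ (lookup σ x))

-- Sums over labellings and ordered products

module Labellings {r ℓ} (R : Ring r ℓ) (m n : ℕ) (E : Fin (m ℕ.+ n) → Fin (m ℕ.+ n) → Ring.Carrier R) where

  open Ring R hiding (zero)
  open GlMN R m n E
  open Algebra.Properties.Ring R
  module Σ′ = Algebra.Properties.Semiring.Sum semiring
  open Σ′ using (sum) public
  open Relation.Binary.Reasoning.Setoid setoid

  sumFin-sum : (f : Fin N → Carrier) → sumFin f ≡ sum f
  sumFin-sum f = foldr-allFin _+_ 0# f id

  sumFin-cong : {f g : Fin N → Carrier} → (∀ a → f a ≈ g a) → sumFin f ≈ sumFin g
  sumFin-cong {f} {g} f≈g = begin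
    sumFin f  ≡⟨ sumFin-sum f ⟩
    sum f     ≈⟨ Σ′.sum-cong-≋ f≈g ⟩
    sum g     ≡⟨ sumFin-sum g ⟨
    sumFin g  ∎

  sumFin-+ : (f g : Fin N → Carrier) → sumFin (λ a → f a + g a) ≈ sumFin f + sumFin g
  sumFin-+ f g = begin
    sumFin (λ a → f a + g a)  ≡⟨ sumFin-sum (λ a → f a + g a) ⟩
    sum (λ a → f a + g a)     ≈⟨ Σ′.∑-distrib-+ f g ⟩
    sum f + sum g             ≡⟨ cong₂ _+_ (sumFin-sum f) (sumFin-sum g) ⟨
    sumFin f + sumFin g       ∎

  sumFin-*ˡ : ∀ x (f : Fin N → Carrier) → x * sumFin f ≈ sumFin (λ a → x * f a)
  sumFin-*ˡ x f = begin
    x * sumFin f            ≡⟨ cong (x *_) (sumFin-sum f) ⟩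
    x * sum f               ≈⟨ Σ′.*-distribˡ-sum x f ⟩
    sum (λ a → x * f a)     ≡⟨ sumFin-sum (λ a → x * f a) ⟨
    sumFin (λ a → x * f a)  ∎

  sumFin-*ʳ : ∀ x (f : Fin N → Carrier) → sumFin f * x ≈ sumFin (λ a → f a * x)
  sumFin-*ʳ x f = begin
    sumFin f * x            ≡⟨ cong (_* x) (sumFin-sum f) ⟩
    sum f * x               ≈⟨ Σ′.*-distribʳ-sum x f ⟩
    sum (λ a → f a * x)     ≡⟨ sumFin-sum (λ a → f a * x) ⟨
    sumFin (λ a → f a * x)  ∎

  sumFin-- : (f g : Fin N → Carrier) → sumFin (λ a → f a - g a) ≈ sumFin f - sumFin g
  sumFin-- f g = begin
    sumFin (λ a → f a - g a)               ≈⟨ sumFin-+ f (λ a → - g a) ⟩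
    sumFin f + sumFin (λ a → - g a)        ≈⟨ +-congˡ (sumFin-cong λ a → -1*x≈-x (g a)) ⟨
    sumFin f + sumFin (λ a → - 1# * g a)   ≈⟨ +-congˡ (sumFin-*ˡ (- 1#) g) ⟨
    sumFin f + - 1# * sumFin g             ≈⟨ +-congˡ (-1*x≈-x (sumFin g)) ⟩
    sumFin f - sumFin g                    ∎

  sumFin-comm : (f : Fin N → Fin N → Carrier) →
    sumFin (λ a → sumFin (f a)) ≈ sumFin (λ b → sumFin (λ a → f a b))
  sumFin-comm f = begin
    sumFin (λ a → sumFin (f a))           ≡⟨ sumFin-sum (λ a → sumFin (f a)) ⟩
    sum (λ a → sumFin (f a))              ≡⟨ Σ′.sum-cong-≗ (λ a → sumFin-sum (f a)) ⟩
    sum (λ a → sum (f a))                 ≈⟨ Σ′.∑-comm f ⟩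
    sum (λ b → sum (λ a → f a b))         ≡⟨ Σ′.sum-cong-≗ (λ b → sumFin-sum (λ a → f a b)) ⟨
    sum (λ b → sumFin (λ a → f a b))      ≡⟨ sumFin-sum (λ b → sumFin (λ a → f a b)) ⟨
    sumFin (λ b → sumFin (λ a → f a b))   ∎

  sum-single : ∀ {k} (f : Fin k → Carrier) c → (∀ a → a ≢ c → f a ≈ 0#) → sum f ≈ f c
  sum-single {suc k} f c f≈0 = begin
    sum f                               ≈⟨ Σ′.sum-remove {i = c} f ⟩
    f c + sum (λ a → f (punchIn c a))   ≈⟨ +-congˡ (Σ′.sum-cong-≋ λ a → f≈0 (punchIn c a) (Finₚ.punchInᵢ≢i c a)) ⟩
    f c + sum {k} (λ _ → 0#)            ≈⟨ +-congˡ (Σ′.sum-replicate-zero k) ⟩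
    f c + 0#                            ≈⟨ +-identityʳ (f c) ⟩
    f c                                 ∎

  sumFin-single : (f : Fin N → Carrier) → ∀ c → (∀ a → a ≢ c → f a ≈ 0#) → sumFin f ≈ f c
  sumFin-single f c f≈0 = trans (reflexive (sumFin-sum f)) (sum-single f c f≈0)

  -- Reindexing a sum over labellings replaces a labelling by a pointwise equal one that is built
  -- differently, so summands must respect pointwise equality.
  Extensional : ∀ {k} → ((Fin k → Fin N) → Carrier) → Set ℓ
  Extensional f = ∀ i j → (∀ x → i x ≡ j x) → f i ≈ f j

  cons-cong : ∀ {k} a {i j : Fin k → Fin N} → (∀ x → i x ≡ j x) → ∀ x → cons a i x ≡ cons a j x
  cons-cong a eq zero = ≡.refl
  cons-cong a eq (suc x) = eq x

  sumLab-cong : ∀ k {f g : (Fin k → Fin N) → Carrier} → (∀ i → f i ≈ g i) → sumLab k f ≈ sumLab k g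
  sumLab-cong zero f≈g = f≈g (λ ())
  sumLab-cong (suc k) f≈g = sumFin-cong λ a → sumLab-cong k λ i → f≈g (cons a i)

  sumLab-*ˡ : ∀ k x (f : (Fin k → Fin N) → Carrier) → x * sumLab k f ≈ sumLab k (λ i → x * f i)
  sumLab-*ˡ zero x f = refl
  sumLab-*ˡ (suc k) x f = trans (sumFin-*ˡ x _) (sumFin-cong λ a → sumLab-*ˡ k x (λ i → f (cons a i)))

  sumLab-*ʳ : ∀ k x (f : (Fin k → Fin N) → Carrier) → sumLab k f * x ≈ sumLab k (λ i → f i * x)
  sumLab-*ʳ zero x f = refl
  sumLab-*ʳ (suc k) x f = trans (sumFin-*ʳ x _) (sumFin-cong λ a → sumLab-*ʳ k x (λ i → f (cons a i)))

  sumLab-- : ∀ k (f g : (Fin k → Fin N) → Carrier) → sumLab k (λ i → f i - g i) ≈ sumLab k f - sumLab k g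
  sumLab-- zero f g = refl
  sumLab-- (suc k) f g = trans
    (sumFin-cong λ a → sumLab-- k (λ i → f (cons a i)) (λ i → g (cons a i))) (sumFin-- _ _)

  sumLab-sumFin : ∀ k (f : Fin N → (Fin k → Fin N) → Carrier) →
    sumLab k (λ i → sumFin (λ a → f a i)) ≈ sumFin (λ a → sumLab k (f a))
  sumLab-sumFin zero f = refl
  sumLab-sumFin (suc k) f = trans
    (sumFin-cong λ b → sumLab-sumFin k (λ a i → f a (cons b i)))
    (sumFin-comm (λ b a → sumLab k (λ i → f a (cons b i))))

  sumLab-insertAt : ∀ {k} (v : Fin (suc k)) (f : (Fin (suc k) → Fin N) → Carrier) → Extensional f →
    sumLab (suc k) f ≈ sumFin (λ a → sumLab k (λ i → f (Vector.insertAt i v a)))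
  sumLab-insertAt {k} zero f ext = sumFin-cong λ a → sumLab-cong k λ i → ext _ _ (same a i)
    where
    same : ∀ {k} a (i : Fin k → Fin N) x → cons a i x ≡ Vector.insertAt i zero a x
    same a i zero = ≡.refl
    same a i (suc x) = ≡.refl
  sumLab-insertAt {suc k} (suc v) f ext = begin
    sumFin (λ b → sumLab (suc k) (λ i → f (cons b i)))
      ≈⟨ (sumFin-cong λ b → sumLab-insertAt v (λ i → f (cons b i)) λ i j eq → ext _ _ (cons-cong b eq)) ⟩
    sumFin (λ b → sumFin (λ a → sumLab k (λ i → f (cons b (Vector.insertAt i v a)))))
      ≈⟨ sumFin-comm _ ⟩
    sumFin (λ a → sumFin (λ b → sumLab k (λ i → f (cons b (Vector.insertAt i v a)))))
      ≈⟨ (sumFin-cong λ a → sumFin-cong λ b → sumLab-cong k λ i → ext _ _ (same a b i)) ⟩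
    sumFin (λ a → sumLab (suc k) (λ i → f (Vector.insertAt i (suc v) a))) ∎
    where
    same : ∀ a b (i : Fin k → Fin N) x → cons b (Vector.insertAt i v a) x ≡ Vector.insertAt (cons b i) (suc v) a x
    same a b i zero = ≡.refl
    same a b i (suc x) = ≡.refl

  punchIn-cover : ∀ {p k} (v : Fin (suc k)) (P : Fin (suc k) → Set p) →
    P v → (∀ x → P (punchIn v x)) → ∀ x → P x
  punchIn-cover v P Pv Px x with v ≟ x
  ... | yes ≡.refl = Pv
  ... | no v≢x = subst P (Finₚ.punchIn-punchOut v≢x) (Px (punchOut v≢x))

  insertAt₂ : ∀ {k} → Fin (suc k) → (Fin k → Fin N) → Fin N → Fin N → Fin (suc (suc k)) → Fin N
  insertAt₂ l i b a = Vector.insertAt (Vector.insertAt i l b) (suc l) a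

  insertAt₂-lower : ∀ {k} (l : Fin (suc k)) i b a → insertAt₂ l i b a (inject₁ l) ≡ b
  insertAt₂-lower l i b a = ≡.trans (cong (insertAt₂ l i b a) (≡.sym (punchIn-suc-same l)))
    (≡.trans (insertAt-punchIn (Vector.insertAt i l b) (suc l) a l) (insertAt-lookup i l b))

  insertAt₂-upper : ∀ {k} (l : Fin (suc k)) i b a → insertAt₂ l i b a (suc l) ≡ a
  insertAt₂-upper l i b a = insertAt-lookup (Vector.insertAt i l b) (suc l) a

  insertAt₂-punchIn : ∀ {k} (l : Fin (suc k)) i b a x → insertAt₂ l i b a (punchIn (suc l) (punchIn l x)) ≡ i x
  insertAt₂-punchIn l i b a x = ≡.trans
    (insertAt-punchIn (Vector.insertAt i l b) (suc l) a (punchIn l x)) (insertAt-punchIn i l b x)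

  swapAt-punchIn₂ : ∀ {k} (l : Fin (suc k)) x → swapAt l (punchIn (suc l) (punchIn l x)) ≡ punchIn (suc l) (punchIn l x)
  swapAt-punchIn₂ l x = ≡.trans (swapAt-punchIn l (punchIn l x))
    (≡.sym (punchIn-suc-other l (punchIn l x) (Finₚ.punchInᵢ≢i l x)))

  insertAt₂-swapAt : ∀ {k} (l : Fin (suc k)) i b a x → insertAt₂ l i a b (swapAt l x) ≡ insertAt₂ l i b a x
  insertAt₂-swapAt l i b a = punchIn-cover (suc l) _
    (≡.trans (cong (insertAt₂ l i a b) (swapAt-suc l))
      (≡.trans (insertAt₂-lower l i a b) (≡.sym (insertAt₂-upper l i b a))))
    (punchIn-cover l _
      (≡.trans (cong (insertAt₂ l i a b) (≡.trans (cong (swapAt l) (punchIn-suc-same l)) (swapAt-inject₁ l)))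
        (≡.trans (insertAt₂-upper l i a b)
          (≡.sym (≡.trans (cong (insertAt₂ l i b a) (punchIn-suc-same l)) (insertAt₂-lower l i b a)))))
      λ x → ≡.trans (cong (insertAt₂ l i a b) (swapAt-punchIn₂ l x))
        (≡.trans (insertAt₂-punchIn l i a b x) (≡.sym (insertAt₂-punchIn l i b a x))))

  insertAt-cong : ∀ {k} {i j : Fin k → Fin N} v a → (∀ x → i x ≡ j x) →
    ∀ x → Vector.insertAt i v a x ≡ Vector.insertAt j v a x
  insertAt-cong {i = i} {j} v a eq = punchIn-cover v _
    (≡.trans (insertAt-lookup i v a) (≡.sym (insertAt-lookup j v a)))
    λ x → ≡.trans (insertAt-punchIn i v a x) (≡.trans (eq x) (≡.sym (insertAt-punchIn j v a x)))

  sumLab-insertAt₂ : ∀ {k} (l : Fin (suc k)) (f : (Fin (suc (suc k)) → Fin N) → Carrier) → Extensional f →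
    sumLab (suc (suc k)) f ≈ sumFin (λ a → sumFin (λ b → sumLab k (λ i → f (insertAt₂ l i b a))))
  sumLab-insertAt₂ l f ext = trans (sumLab-insertAt (suc l) f ext)
    (sumFin-cong λ a → sumLab-insertAt l (λ i → f (Vector.insertAt i (suc l) a))
      λ i j eq → ext _ _ (insertAt-cong (suc l) a eq))

  -- Once the two labels at `l` and `l+1` are summed outermost, exchanging them is an exchange of
  -- two independent sums.
  sumLab-swapAt : ∀ {k} (l : Fin (suc k)) (f : (Fin (suc (suc k)) → Fin N) → Carrier) → Extensional f →
    sumLab (suc (suc k)) f ≈ sumLab (suc (suc k)) (λ i → f (i ∘ swapAt l))
  sumLab-swapAt {k} l f ext = begin
    sumLab (suc (suc k)) f
      ≈⟨ sumLab-insertAt₂ l f ext ⟩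
    sumFin (λ b → sumFin (λ a → sumLab k (λ i → f (insertAt₂ l i a b))))
      ≈⟨ sumFin-comm (λ b a → sumLab k (λ i → f (insertAt₂ l i a b))) ⟩
    sumFin (λ a → sumFin (λ b → sumLab k (λ i → f (insertAt₂ l i a b))))
      ≈⟨ (sumFin-cong λ a → sumFin-cong λ b → sumLab-cong k λ i → ext _ _ λ x →
           ≡.trans (cong (insertAt₂ l i a b) (≡.sym (swapAt-involutive l x))) (insertAt₂-swapAt l i b a (swapAt l x))) ⟩
    sumFin (λ a → sumFin (λ b → sumLab k (λ i → f (insertAt₂ l i b a ∘ swapAt l))))
      ≈⟨ sumLab-insertAt₂ l (λ i → f (i ∘ swapAt l)) (λ i j eq → ext _ _ (eq ∘ swapAt l)) ⟨
    sumLab (suc (suc k)) (λ i → f (i ∘ swapAt l)) ∎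

  sumLab-++ : ∀ k {j} (f : (Fin (k ℕ.+ j) → Fin N) → Carrier) → Extensional f →
    sumLab (k ℕ.+ j) f ≈ sumLab k (λ i → sumLab j (λ i′ → f (i Vector.++ i′)))
  sumLab-++ zero {j} f ext = sumLab-cong j λ i′ → ext _ _ λ x → ≡.refl
  sumLab-++ (suc k) {j} f ext = sumFin-cong λ a → trans
    (sumLab-++ k (λ i → f (cons a i)) λ i i′ eq → ext _ _ (cons-cong a eq))
    (sumLab-cong k λ i → sumLab-cong j λ i′ → ext _ _ (same a i i′))
    where
    same : ∀ a (i : Fin k → Fin N) (i′ : Fin j → Fin N) x → cons a (i Vector.++ i′) x ≡ (cons a i Vector.++ i′) x
    same a i i′ zero = ≡.refl
    same a i i′ (suc x) with splitAt k x
    ... | inj₁ _ = ≡.refl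
    ... | inj₂ _ = ≡.refl

  -- Products

  prod : ∀ {k} → (Fin k → Carrier) → Carrier
  prod = Vector.foldr _*_ 1#

  prodFin-prod : ∀ k (g : Fin k → Carrier) → prodFin k g ≡ prod g
  prodFin-prod k g = foldr-allFin _*_ 1# g id

  prod-cong : ∀ {k} {g h : Fin k → Carrier} → (∀ x → g x ≈ h x) → prod g ≈ prod h
  prod-cong {zero} g≈h = refl
  prod-cong {suc k} g≈h = *-cong (g≈h zero) (prod-cong (g≈h ∘ suc))

  prod-++ : ∀ k {j} (g : Fin (k ℕ.+ j) → Carrier) → prod g ≈ prod (g ∘ (_↑ˡ j)) * prod (g ∘ (k ↑ʳ_))
  prod-++ zero g = sym (*-identityˡ _)
  prod-++ (suc k) g = trans (*-congˡ (prod-++ k (g ∘ suc))) (sym (*-assoc _ _ _))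

  -- The ring need not be commutative; the two factors can be combined because they stand next to
  -- each other.
  prod-merge : ∀ {k} (l : Fin (suc k)) (g : Fin (suc (suc k)) → Carrier) (h : Fin (suc k) → Carrier) →
    h l ≈ g (inject₁ l) * g (suc l) → (∀ x → h (punchIn l x) ≈ g (punchIn (suc l) (punchIn l x))) →
    prod g ≈ prod h
  prod-merge zero g h hl hx = trans (sym (*-assoc _ _ _)) (*-cong (sym hl) (prod-cong λ x → sym (hx x)))
  prod-merge {suc k} (suc l) g h hl hx =
    *-cong (sym (hx zero)) (prod-merge l (g ∘ suc) (h ∘ suc) hl (hx ∘ suc))

  prod-insertAt-+ : ∀ {k} (g : Fin k → Carrier) l x y →
    prod (Vector.insertAt g l (x + y)) ≈ prod (Vector.insertAt g l x) + prod (Vector.insertAt g l y)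
  prod-insertAt-+ g zero x y = distribʳ _ x y
  prod-insertAt-+ {suc k} g (suc l) x y =
    trans (*-congˡ (prod-insertAt-+ (g ∘ suc) l x y)) (distribˡ _ _ _)

  prod-insertAt-central : ∀ {k} (g : Fin k → Carrier) l z x → (∀ y → z * g y ≈ g y * z) →
    prod (Vector.insertAt g l (z * x)) ≈ z * prod (Vector.insertAt g l x)
  prod-insertAt-central g zero z x _ = *-assoc z x _
  prod-insertAt-central {suc k} g (suc l) z x central = begin
    g zero * prod (Vector.insertAt (g ∘ suc) l (z * x))   ≈⟨ *-congˡ (prod-insertAt-central (g ∘ suc) l z x (central ∘ suc)) ⟩
    g zero * (z * prod (Vector.insertAt (g ∘ suc) l x))   ≈⟨ *-assoc _ _ _ ⟨
    g zero * z * prod (Vector.insertAt (g ∘ suc) l x)     ≈⟨ *-congʳ (central zero) ⟨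
    z * g zero * prod (Vector.insertAt (g ∘ suc) l x)     ≈⟨ *-assoc _ _ _ ⟩
    z * (g zero * prod (Vector.insertAt (g ∘ suc) l x))   ∎

  prod-insertAt-0 : ∀ {k} (g : Fin k → Carrier) l → prod (Vector.insertAt g l 0#) ≈ 0#
  prod-insertAt-0 g zero = zeroˡ _
  prod-insertAt-0 {suc k} g (suc l) = trans (*-congˡ (prod-insertAt-0 (g ∘ suc) l)) (zeroʳ _)

  prod-insertAt-cong : ∀ {k} {g h : Fin k → Carrier} l {x y} → (∀ z → g z ≈ h z) → x ≈ y →
    prod (Vector.insertAt g l x) ≈ prod (Vector.insertAt h l y)
  prod-insertAt-cong zero g≈h x≈y = *-cong x≈y (prod-cong g≈h)
  prod-insertAt-cong {suc k} (suc l) g≈h x≈y = *-cong (g≈h zero) (prod-insertAt-cong l (g≈h ∘ suc) x≈y)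

  prod-insertAt-1 : ∀ {k} (g : Fin k → Carrier) l → prod (Vector.insertAt g l 1#) ≈ prod g
  prod-insertAt-1 g zero = *-identityˡ _
  prod-insertAt-1 {suc k} g (suc l) = *-congˡ (prod-insertAt-1 (g ∘ suc) l)

  prod-insertAt-sumFin : ∀ {k} (g : Fin k → Carrier) l (f : Fin N → Carrier) →
    prod (Vector.insertAt g l (sumFin f)) ≈ sumFin (λ a → prod (Vector.insertAt g l (f a)))
  prod-insertAt-sumFin g zero f = sumFin-*ʳ _ f
  prod-insertAt-sumFin {suc k} g (suc l) f =
    trans (*-congˡ (prod-insertAt-sumFin (g ∘ suc) l f)) (sumFin-*ˡ (g zero) _)

  prod-removeAt : ∀ {k} (v : Fin (suc k)) (g : Fin (suc k) → Carrier) →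
    prod g ≈ prod (Vector.insertAt (g ∘ punchIn v) v (g v))
  prod-removeAt v g = prod-cong λ x → reflexive (≡.sym (insertAt-removeAt g v x))

  -- Signs

  sgn-xor : ∀ a b → sgn (a xor b) ≈ sgn a * sgn b
  sgn-xor true true = sym (trans (-1*x≈-x _) (-‿involutive 1#))
  sgn-xor true false = sym (*-identityʳ _)
  sgn-xor false b = sym (*-identityˡ _)

  sgn-central : ∀ a x → sgn a * x ≈ x * sgn a
  sgn-central true x = trans (-1*x≈-x x) (trans (-‿cong (sym (*-identityʳ x))) (-‿distribʳ-* x 1#))
  sgn-central false x = trans (*-identityˡ x) (sym (*-identityʳ x))

  δ-yes : ∀ {a b} x → a ≡ b → δ a b x ≡ x
  δ-yes {a} {b} x a≡b rewrite dec-true (a ≟ b) a≡b = ≡.refl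

  δ-no : ∀ {a b} x → a ≢ b → δ a b x ≡ 0#
  δ-no {a} {b} x a≢b rewrite dec-false (a ≟ b) a≢b = ≡.refl

  δ-sym : ∀ a b x → δ a b x ≡ δ b a x
  δ-sym a b x with a ≟ b
  ... | yes ≡.refl = ≡.sym (δ-yes {a} {a} x ≡.refl)
  ... | no a≢b = ≡.sym (δ-no x (a≢b ∘ ≡.sym))

  sumFin-δ : ∀ b (f : Fin N → Carrier) → sumFin (λ a → δ a b (f a)) ≈ f b
  sumFin-δ b f = trans
    (sumFin-single (λ a → δ a b (f a)) b λ a a≢b → reflexive (δ-no (f a) a≢b))
    (reflexive (δ-yes {b} {b} (f b) ≡.refl))

-- The weight system of gl(m|n)

module Weights {r ℓ} (R : Ring r ℓ) (m n : ℕ) (E : Fin (m ℕ.+ n) → Fin (m ℕ.+ n) → Ring.Carrier R)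
  (relations : GlMN.SatisfiesRelations R m n E) where

  open Ring R hiding (zero)
  open GlMN R m n E
  open Algebra.Properties.Ring R
  open Labellings R m n E
  open Relation.Binary.Reasoning.Setoid setoid

  entries : ∀ {k} → Perm k → (Fin k → Fin N) → Fin k → Carrier
  entries σ i x = E (i x) (i (lookup σ x))

  summand : ∀ {k} → Perm k → (Fin k → Fin N) → Carrier
  summand σ i = sgn (sign σ (par ∘ i)) * prod (entries σ i)

  weight : (k : ℕ) → Perm k → Carrier
  weight k σ = sumLab k (summand σ)

  wglmn-weight : ∀ k (σ : Perm k) → IsPerm σ → wglmn k σ ≈ weight k σ
  wglmn-weight k σ perm = sumLab-cong k λ i → *-cong
    (reflexive (cong sgn (fσ-sign R m n E σ perm i))) (reflexive (prodFin-prod k (entries σ i)))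

  entries-cong : ∀ {k} (σ : Perm k) {i j : Fin k → Fin N} → (∀ x → i x ≡ j x) → ∀ x → entries σ i x ≈ entries σ j x
  entries-cong σ eq x = reflexive (cong₂ E (eq x) (eq (lookup σ x)))

  sgn-sign-cong : ∀ {k} (σ : Perm k) {c d : Fin k → Bool} → (∀ x → c x ≡ d x) → sgn (sign σ c) ≈ sgn (sign σ d)
  sgn-sign-cong σ eq = reflexive (cong sgn (sign-cong σ eq))

  summand-ext : ∀ {k} (σ : Perm k) → Extensional (summand σ)
  summand-ext σ i j eq = *-cong (sgn-sign-cong σ (cong par ∘ eq)) (prod-cong (entries-cong σ eq))

  -- Concatenations and cycles

  -- The matrix units already stand block by block, so only the sign of `ρ` has to move past the
  -- product of `σ`, and signs are central.
  weight-⊔ₚ : ∀ {k j} (σ : Perm k) (ρ : Perm j) → weight (k ℕ.+ j) (σ ⊔ₚ ρ) ≈ weight k σ * weight j ρ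
  weight-⊔ₚ {k} {j} σ ρ = begin
    weight (k ℕ.+ j) (σ ⊔ₚ ρ)
      ≈⟨ sumLab-++ k (summand (σ ⊔ₚ ρ)) (summand-ext (σ ⊔ₚ ρ)) ⟩
    sumLab k (λ i → sumLab j (λ i′ → summand (σ ⊔ₚ ρ) (i Vector.++ i′)))
      ≈⟨ (sumLab-cong k λ i → sumLab-cong j λ i′ → factor i i′) ⟩
    sumLab k (λ i → sumLab j (λ i′ → summand σ i * summand ρ i′))
      ≈⟨ (sumLab-cong k λ i → sumLab-*ˡ j (summand σ i) (summand ρ)) ⟨
    sumLab k (λ i → summand σ i * weight j ρ)
      ≈⟨ sumLab-*ʳ k (weight j ρ) (summand σ) ⟨
    weight k σ * weight j ρ ∎
    where
    factor : ∀ i i′ → summand (σ ⊔ₚ ρ) (i Vector.++ i′) ≈ summand σ i * summand ρ i′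
    factor i i′ = begin
      sgn (sign (σ ⊔ₚ ρ) (par ∘ q)) * prod (entries (σ ⊔ₚ ρ) q)
        ≈⟨ *-cong (trans (reflexive (cong sgn (sign-⊔ₚ σ ρ (par ∘ q)))) (sgn-xor (sign σ (par ∘ q ∘ (_↑ˡ j))) _))
                  (prod-++ k (entries (σ ⊔ₚ ρ) q)) ⟩
      sgn (sign σ (par ∘ q ∘ (_↑ˡ j))) * sgn (sign ρ (par ∘ q ∘ (k ↑ʳ_))) *
        (prod (entries (σ ⊔ₚ ρ) q ∘ (_↑ˡ j)) * prod (entries (σ ⊔ₚ ρ) q ∘ (k ↑ʳ_)))
        ≈⟨ *-cong
             (*-cong (sgn-sign-cong σ (cong par ∘ left)) (sgn-sign-cong ρ (cong par ∘ right)))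
             (*-cong (prod-cong λ x → reflexive (cong₂ E (left x) (≡.trans (cong q (lookup-⊔ₚˡ σ ρ x)) (left _))))
                     (prod-cong λ x → reflexive (cong₂ E (right x) (≡.trans (cong q (lookup-⊔ₚʳ σ ρ x)) (right _))))) ⟩
      sgn a * sgn b * (prod (entries σ i) * prod (entries ρ i′))
        ≈⟨ *-assoc _ _ _ ⟩
      sgn a * (sgn b * (prod (entries σ i) * prod (entries ρ i′)))
        ≈⟨ *-congˡ (trans (sym (*-assoc _ _ _)) (*-congʳ (sgn-central b _))) ⟩
      sgn a * (prod (entries σ i) * sgn b * prod (entries ρ i′))
        ≈⟨ trans (*-congˡ (*-assoc _ _ _)) (sym (*-assoc _ _ _)) ⟩
      summand σ i * summand ρ i′ ∎
      where
      q = i Vector.++ i′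
      a = sign σ (par ∘ i)
      b = sign ρ (par ∘ i′)
      left : ∀ x → q (x ↑ˡ j) ≡ i x
      left x rewrite Finₚ.splitAt-↑ˡ k x j = ≡.refl
      right : ∀ x → q (k ↑ʳ x) ≡ i′ x
      right x rewrite Finₚ.splitAt-↑ʳ k j x = ≡.refl

  weight-cyclePerm : ∀ k → weight (suc k) (cyclePerm k) ≈ casimir k
  weight-cyclePerm k = sumLab-cong (suc k) λ i → *-cong
    (reflexive (cong sgn (≡.trans (sign-cyclePerm k (par ∘ i)) (≡.sym (xorL-map R m n E (λ t → par (i (suc t))))))))
    (trans (prod-cong λ x → reflexive (cong (λ y → E (i x) (i y)) (lookup-cyclePerm k x)))
           (reflexive (≡.sym (prodFin-prod (suc k) (λ t → E (i t) (i (cyc t)))))))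

  -- Exchanging two neighbouring vertices

  -- The ordered product with its neighbouring factors at `l` and `l+1` replaced by the single
  -- factor `z`: the context in which the supercommutator stands.
  contract : ∀ {k} → Fin (suc k) → (Fin (suc (suc k)) → Carrier) → Carrier → Carrier
  contract l g z = prod (Vector.insertAt (g ∘ punchIn (suc l) ∘ punchIn l) l z)

  prod-contract : ∀ {k} (l : Fin (suc k)) g → prod g ≈ contract l g (g (inject₁ l) * g (suc l))
  prod-contract l g = prod-merge l g (Vector.insertAt (g ∘ punchIn (suc l) ∘ punchIn l) l (g (inject₁ l) * g (suc l)))
    (reflexive (insertAt-lookup (g ∘ punchIn (suc l) ∘ punchIn l) l _))
    (λ x → reflexive (insertAt-punchIn (g ∘ punchIn (suc l) ∘ punchIn l) l _ x))

  contract-swapAt : ∀ {k} (l : Fin (suc k)) g z → contract l (g ∘ swapAt l) z ≈ contract l g z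
  contract-swapAt l g z = prod-insertAt-cong l (λ x → reflexive (cong g (swapAt-punchIn₂ l x))) refl

  contract-cong : ∀ {k} (l : Fin (suc k)) {g h} {y z} → (∀ x → g x ≈ h x) → y ≈ z → contract l g y ≈ contract l h z
  contract-cong l g≈h = prod-insertAt-cong l (λ x → g≈h _)

  contract-linear : ∀ {k} (l : Fin (suc k)) g b x y →
    contract l g (x - sgn b * y) ≈ contract l g x - sgn b * contract l g y
  contract-linear l g b x y = begin
    contract l g (x - sgn b * y)
      ≈⟨ prod-insertAt-+ g′ l x (- (sgn b * y)) ⟩
    contract l g x + contract l g (- (sgn b * y))
      ≈⟨ +-congˡ (prod-insertAt-cong l (λ _ → refl) (trans (-‿cong refl) (sym (-1*x≈-x (sgn b * y))))) ⟩
    contract l g x + contract l g (- 1# * (sgn b * y))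
      ≈⟨ +-congˡ (trans (prod-insertAt-central g′ l (- 1#) _ (λ z → sgn-central true (g′ z)))
                        (*-congˡ (prod-insertAt-central g′ l (sgn b) y (λ z → sgn-central b (g′ z))))) ⟩
    contract l g x + - 1# * (sgn b * contract l g y)
      ≈⟨ +-congˡ (-1*x≈-x _) ⟩
    contract l g x - sgn b * contract l g y ∎
    where g′ = g ∘ punchIn (suc l) ∘ punchIn l

  -- With `E a b` at `l` and `E c d` at `l+1`, the inserted factor is the term `δ b c (E a d)` of
  -- their supercommutator. The sign is still the one of the unmerged `σ`.
  mergeSummand : ∀ {k} → Fin (suc k) → Perm (suc (suc k)) → (Fin (suc (suc k)) → Fin N) → Carrier
  mergeSummand l σ i = sgn (sign σ (par ∘ i)) * contract l (entries σ i)
    (δ (i (lookup σ (inject₁ l))) (i (suc l)) (E (i (inject₁ l)) (i (lookup σ (suc l)))))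

  mergeSummand-ext : ∀ {k} (l : Fin (suc k)) (σ : Perm (suc (suc k))) → Extensional (mergeSummand l σ)
  mergeSummand-ext l σ i j eq = *-cong (sgn-sign-cong σ (cong par ∘ eq))
    (contract-cong l (entries-cong σ eq) (reflexive (δ-cong (eq _) (eq _) (cong₂ E (eq _) (eq _)))))
    where
    δ-cong : ∀ {a a′ b b′ x x′} → a ≡ a′ → b ≡ b′ → x ≡ x′ → δ a b x ≡ δ a′ b′ x′
    δ-cong ≡.refl ≡.refl ≡.refl = ≡.refl

  -- The first half of the supercommutator of the factors at l and l+1.
  merged : ∀ {k} → Fin (suc k) → Perm (suc (suc k)) → Carrier
  merged l σ = sumLab _ (mergeSummand l σ)

  -- After its labels are renumbered by `τ`, the summand of `τστ` has the same factors as that of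
  -- `σ` with the two neighbours exchanged, and its sign differs by the product of their parities.
  -- The difference therefore contains the left side of the defining relation. The term
  -- `δ a d (E c b)` on the right is the merged term of `τστ`, so no second kind of merging arises.
  weight-conjτ : ∀ {k} (l : Fin (suc k)) (σ : Perm (suc (suc k))) → IsPerm σ →
    weight _ σ - weight _ (conjτ l σ) ≈ merged l σ - merged l (conjτ l σ)
  weight-conjτ {k} l σ perm = begin
    weight K σ - weight K σ′
      ≈⟨ +-congˡ (-‿cong (sumLab-swapAt l (summand σ′) (summand-ext σ′))) ⟩
    weight K σ - sumLab K (λ i → summand σ′ (i ∘ τ))
      ≈⟨ sumLab-- K (summand σ) (λ i → summand σ′ (i ∘ τ)) ⟨
    sumLab K (λ i → summand σ i - summand σ′ (i ∘ τ))
      ≈⟨ sumLab-cong K exchange ⟩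
    sumLab K (λ i → mergeSummand l σ i - mergeSummand l σ′ (i ∘ τ))
      ≈⟨ sumLab-- K (mergeSummand l σ) (λ i → mergeSummand l σ′ (i ∘ τ)) ⟩
    merged l σ - sumLab K (λ i → mergeSummand l σ′ (i ∘ τ))
      ≈⟨ +-congˡ (-‿cong (sumLab-swapAt l (mergeSummand l σ′) (mergeSummand-ext l σ′))) ⟨
    merged l σ - merged l σ′ ∎
    where
    K : ℕ
    K = suc (suc k)
    σ′ = conjτ l σ
    τ = swapAt l
    module _ (i : Fin K → Fin N) where
      a = i (inject₁ l)
      b = i (lookup σ (inject₁ l))
      c = i (suc l)
      d = i (lookup σ (suc l))
      s = (par a xor par b) ∧ (par c xor par d)
      f = sign σ (par ∘ i)
      g = entries σ i
      sgn-τ : sgn (sign σ′ (par ∘ i ∘ τ)) ≈ sgn f * sgn s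
      sgn-τ = trans (reflexive (cong sgn (sign-conjτ l σ perm (par ∘ i)))) (sgn-xor f s)
      iτσ′ : ∀ x → i (τ (lookup σ′ x)) ≡ i (lookup σ (τ x))
      iτσ′ x = cong i (≡.trans (cong τ (lookup-conjτ l σ x)) (swapAt-involutive l _))
      entries-τ : ∀ x → entries σ′ (i ∘ τ) x ≈ g (τ x)
      entries-τ x = reflexive (cong (E (i (τ x))) (iτσ′ x))
      prod-τ : prod (g ∘ τ) ≈ contract l g (g (suc l) * g (inject₁ l))
      prod-τ = trans (prod-contract l (g ∘ τ)) (trans (contract-swapAt l g _)
        (contract-cong l {g} {g} (λ _ → refl) (reflexive (cong₂ _*_ (cong g (swapAt-inject₁ l)) (cong g (swapAt-suc l))))))
      δ-τ : δ (i (τ (lookup σ′ (inject₁ l)))) (i (τ (suc l)))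
              (E (i (τ (inject₁ l))) (i (τ (lookup σ′ (suc l))))) ≡ δ a d (E c b)
      δ-τ rewrite iτσ′ (inject₁ l) | iτσ′ (suc l) | swapAt-inject₁ l | swapAt-suc l = δ-sym d a (E c b)
      exchange : summand σ i - summand σ′ (i ∘ τ) ≈ mergeSummand l σ i - mergeSummand l σ′ (i ∘ τ)
      exchange = begin
        sgn f * prod g - sgn (sign σ′ (par ∘ i ∘ τ)) * prod (entries σ′ (i ∘ τ))
          ≈⟨ +-cong (*-congˡ (prod-contract l g)) (-‿cong (trans
               (*-cong sgn-τ (trans (prod-cong entries-τ) prod-τ)) (*-assoc _ _ _))) ⟩
        sgn f * contract l g (E a b * E c d) - sgn f * (sgn s * contract l g (E c d * E a b))
          ≈⟨ x[y-z]≈xy-xz _ _ _ ⟨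
        sgn f * (contract l g (E a b * E c d) - sgn s * contract l g (E c d * E a b))
          ≈⟨ *-congˡ (trans (sym (contract-linear l g s _ _))
               (trans (contract-cong l {g} {g} (λ _ → refl) (relations a b c d)) (contract-linear l g s _ _))) ⟩
        sgn f * (contract l g (δ b c (E a d)) - sgn s * contract l g (δ a d (E c b)))
          ≈⟨ x[y-z]≈xy-xz _ _ _ ⟩
        mergeSummand l σ i - sgn f * (sgn s * contract l g (δ a d (E c b)))
          ≈⟨ +-congˡ (-‿cong (trans
               (*-cong sgn-τ (trans (contract-cong l {entries σ′ (i ∘ τ)} {g ∘ τ} entries-τ (reflexive δ-τ)) (contract-swapAt l g _))) (*-assoc _ _ _))) ⟨
        mergeSummand l σ i - mergeSummand l σ′ (i ∘ τ) ∎

  -- Evaluation of the merged terms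

  contract-prod : ∀ {k} (l : Fin (suc k)) g {z} (h : Fin (suc k) → Carrier) →
    z ≈ h l → (∀ x → g (punchIn (suc l) (punchIn l x)) ≈ h (punchIn l x)) → contract l g z ≈ prod h
  contract-prod l g h z≈ g≈ = trans (prod-insertAt-cong l g≈ z≈) (sym (prod-removeAt l h))

  -- `E a d` keeps the label entering `l` and the label leaving `l+1`, hence is the factor of the
  -- merged vertex. Joining two edges and freeing a label differ only in how the hypothesis on
  -- labels is met.
  contract-entries : ∀ {k} (l : Fin (suc k)) (σ : Perm (suc (suc k))) (ρ : Perm (suc k)) a (j : Fin (suc k) → Fin N) →
    (∀ x → Vector.insertAt j (suc l) a (lookup σ (punchIn (inject₁ l) x)) ≡ j (lookup ρ x)) →
    let i = Vector.insertAt j (suc l) a in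
    contract l (entries σ i) (E (i (inject₁ l)) (i (lookup σ (suc l)))) ≈ prod (entries ρ j)
  contract-entries l σ ρ a j label = contract-prod l (entries σ i) (entries ρ j)
    (reflexive (cong₂ E
      (≡.trans (cong i (≡.sym (punchIn-suc-same l))) (insertAt-punchIn j (suc l) a l))
      (≡.trans (cong (i ∘ lookup σ) (≡.sym (punchIn-inject₁-same l))) (label l))))
    (λ x → reflexive (cong₂ E (insertAt-punchIn j (suc l) a (punchIn l x))
      (≡.trans (cong (i ∘ lookup σ) (punchIn-suc-other l (punchIn l x) (Finₚ.punchInᵢ≢i l x))) (label (punchIn l x)))))
    where i = Vector.insertAt j (suc l) a

  sumLab-insertAt′ : ∀ {k} (v : Fin (suc k)) (f : (Fin (suc k) → Fin N) → Carrier) → Extensional f →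
    sumLab (suc k) f ≈ sumLab k (λ j → sumFin (λ a → f (Vector.insertAt j v a)))
  sumLab-insertAt′ {k} v f ext =
    trans (sumLab-insertAt v f ext) (sym (sumLab-sumFin k (λ a j → f (Vector.insertAt j v a))))

  -- The factor `δ` forces the edge into `l+1` to carry the label of the edge out of `l`, so the sum
  -- over its label has one surviving term, and by `sign-join` the two edges become one without a
  -- change of sign.
  merged-join : ∀ {k} (l : Fin (suc k)) (σ : Perm (suc (suc k))) → IsPerm σ → lookup σ (inject₁ l) ≢ suc l →
    merged l σ ≈ weight (suc k) (D l (compτ l σ))
  merged-join {k} l σ perm σl≢v = trans
    (sumLab-insertAt′ (suc l) (mergeSummand l σ) (mergeSummand-ext l σ))
    (sumLab-cong (suc k) λ j → trans
      (sumFin-single (λ a → mergeSummand l σ (Vector.insertAt j (suc l) a)) (j b) (off-diagonal j))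
      (on-diagonal j))
    where
    ρ = D l (compτ l σ)
    v≢σl : suc l ≢ lookup σ (inject₁ l)
    v≢σl = σl≢v ∘ ≡.sym
    -- The vertex `σ(l)` in the numbering without `l+1`, so that `j b` is the label of the edge
    -- leaving `l`.
    b : Fin (suc k)
    b = punchOut v≢σl
    module _ (j : Fin (suc k) → Fin N) where
      at-σl : ∀ a → Vector.insertAt j (suc l) a (lookup σ (inject₁ l)) ≡ j b
      at-σl a = ≡.trans (cong (Vector.insertAt j (suc l) a) (≡.sym (Finₚ.punchIn-punchOut v≢σl)))
        (insertAt-punchIn j (suc l) a b)
      off-diagonal : ∀ a → a ≢ j b → mergeSummand l σ (Vector.insertAt j (suc l) a) ≈ 0#
      off-diagonal a a≢jb = begin
        sgn (sign σ (par ∘ i)) * contract l (entries σ i) (δ (i (lookup σ (inject₁ l))) (i (suc l)) z)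
          ≡⟨ cong (λ w → sgn (sign σ (par ∘ i)) * contract l (entries σ i) w)
               (δ-no z λ eq → a≢jb (≡.trans (≡.sym (insertAt-lookup j (suc l) a)) (≡.trans (≡.sym eq) (at-σl a)))) ⟩
        sgn (sign σ (par ∘ i)) * contract l (entries σ i) 0#
          ≈⟨ trans (*-congˡ (prod-insertAt-0 _ l)) (zeroʳ _) ⟩
        0# ∎
        where
        i = Vector.insertAt j (suc l) a
        z = E (i (inject₁ l)) (i (lookup σ (suc l)))
      i = Vector.insertAt j (suc l) (j b)
      iσl≡iv : i (lookup σ (inject₁ l)) ≡ i (suc l)
      iσl≡iv = ≡.trans (at-σl (j b)) (≡.sym (insertAt-lookup j (suc l) (j b)))
      label : ∀ x → i (lookup σ (punchIn (inject₁ l) x)) ≡ j (lookup ρ x)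
      label x with lookup σ (punchIn (inject₁ l) x) ≟ suc l
      ... | yes eq = ≡.trans (cong i eq) (≡.trans (≡.sym iσl≡iv)
              (≡.trans (cong i (≡.sym (punchIn-D-join l σ perm x eq))) (insertAt-punchIn j (suc l) (j b) (lookup ρ x))))
      ... | no neq = ≡.trans (cong i (≡.sym (punchIn-D l σ perm x neq))) (insertAt-punchIn j (suc l) (j b) (lookup ρ x))
      on-diagonal : mergeSummand l σ i ≈ summand ρ j
      on-diagonal = *-cong
        (reflexive (cong sgn (≡.trans (sign-join l σ perm σl≢v (par ∘ i) (cong par (≡.sym iσl≡iv)))
          (sign-cong ρ λ x → cong par (insertAt-punchIn j (suc l) (j b) x)))))
        (trans (reflexive (cong (contract l (entries σ i)) (δ-yes (E (i (inject₁ l)) (i (lookup σ (suc l)))) iσl≡iv)))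
               (contract-entries l σ ρ (j b) j label))

  supertrace : Carrier
  supertrace = sumFin (λ a → sgn (par a))

  -- Both indices of `δ` are the label of the one edge `l → l+1`, so `δ` imposes nothing. This label
  -- has left all factors and remains only in the sign.
  merged-step : ∀ {k} (l : Fin (suc k)) (σ : Perm (suc (suc k))) → IsPerm σ → lookup σ (inject₁ l) ≡ suc l →
    merged l σ ≈ supertrace * weight (suc k) (D l σ)
  merged-step {k} l σ perm σl≡v = begin
    merged l σ
      ≈⟨ sumLab-insertAt′ (suc l) (mergeSummand l σ) (mergeSummand-ext l σ) ⟩
    sumLab (suc k) (λ j → sumFin (λ a → mergeSummand l σ (Vector.insertAt j (suc l) a)))
      ≈⟨ (sumLab-cong (suc k) λ j → trans (sumFin-cong (split j)) (sym (sumFin-*ʳ (summand ρ j) (λ a → sgn (par a))))) ⟩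
    sumLab (suc k) (λ j → supertrace * summand ρ j)
      ≈⟨ sumLab-*ˡ (suc k) supertrace (summand ρ) ⟨
    supertrace * weight (suc k) ρ ∎
    where
    ρ = D l σ
    split : ∀ j a → mergeSummand l σ (Vector.insertAt j (suc l) a) ≈ sgn (par a) * summand ρ j
    split j a = trans (*-cong
      (trans (reflexive (cong sgn (≡.trans (sign-step l σ perm σl≡v (par ∘ i))
               (cong₂ _xor_ (cong par (insertAt-lookup j (suc l) a))
                  (sign-cong ρ λ x → cong par (insertAt-punchIn j (suc l) a x))))))
             (sgn-xor (par a) (sign ρ (par ∘ j))))
      (trans (reflexive (cong (contract l (entries σ i)) (δ-yes (E (i (inject₁ l)) (i (lookup σ (suc l)))) (cong i σl≡v))))
             (contract-entries l σ ρ a j λ x →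
               ≡.trans (cong i (≡.sym (punchIn-D-step l σ perm x σl≡v))) (insertAt-punchIn j (suc l) a (lookup ρ x)))))
      (*-assoc _ _ _)
      where i = Vector.insertAt j (suc l) a

  -- Fixed points and the trace element

  trace : Carrier
  trace = sumFin (λ a → E a a)

  casimir-trace : casimir 0 ≈ trace
  casimir-trace = sumFin-cong λ a → trans (*-identityˡ _) (*-identityʳ _)

  E-diagonal : ∀ a c d → E a a * E c d - E c d * E a a ≈ δ a c (E a d) - δ a d (E c a)
  E-diagonal a c d = begin
    E a a * E c d - E c d * E a a
      ≈⟨ +-congˡ (-‿cong (trans (*-congʳ sign≈1) (*-identityˡ _))) ⟨
    E a a * E c d - s * (E c d * E a a)
      ≈⟨ relations a a c d ⟩
    δ a c (E a d) - s * δ a d (E c a)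
      ≈⟨ +-congˡ (-‿cong (trans (*-congʳ sign≈1) (*-identityˡ _))) ⟩
    δ a c (E a d) - δ a d (E c a) ∎
    where
    s = sgn ((par a xor par a) ∧ (par c xor par d))
    sign≈1 : s ≈ 1#
    sign≈1 rewrite Boolₚ.xor-same (par a) = refl

  -- Each `E a a` is even, so its supercommutator is a commutator; summed over `a`, both `δ`-terms
  -- leave `E c d` and cancel.
  trace-central : ∀ c d → trace * E c d ≈ E c d * trace
  trace-central c d = x∙y⁻¹≈ε⇒x≈y _ _ (begin
    trace * E c d - E c d * trace
      ≈⟨ +-cong (sumFin-*ʳ (E c d) (λ a → E a a)) (-‿cong (sumFin-*ˡ (E c d) (λ a → E a a))) ⟩
    sumFin (λ a → E a a * E c d) - sumFin (λ a → E c d * E a a)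
      ≈⟨ sumFin-- _ _ ⟨
    sumFin (λ a → E a a * E c d - E c d * E a a)
      ≈⟨ (sumFin-cong λ a → E-diagonal a c d) ⟩
    sumFin (λ a → δ a c (E a d) - δ a d (E c a))
      ≈⟨ sumFin-- _ _ ⟩
    sumFin (λ a → δ a c (E a d)) - sumFin (λ a → δ a d (E c a))
      ≈⟨ +-cong (sumFin-δ c (λ a → E a d)) (-‿cong (sumFin-δ d (λ a → E c a))) ⟩
    E c d - E c d
      ≈⟨ -‿inverseʳ (E c d) ⟩
    0# ∎)

  -- The label of a loop occurs in no other factor and drops out of the sign, so its sum puts
  -- `trace` at position `v`, from where centrality moves it to the front.
  weight-loop : ∀ {k} (v : Fin (suc k)) (π : Perm (suc k)) → IsPerm π → lookup π v ≡ v →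
    weight (suc k) π ≈ trace * weight k (del v π)
  weight-loop {k} v π perm πv≡v = begin
    weight (suc k) π
      ≈⟨ sumLab-insertAt′ v (summand π) (summand-ext π) ⟩
    sumLab k (λ j → sumFin (λ a → summand π (Vector.insertAt j v a)))
      ≈⟨ (sumLab-cong k λ j → trans (sumFin-cong (split j)) (collect j)) ⟩
    sumLab k (λ j → trace * summand ρ j)
      ≈⟨ sumLab-*ˡ k trace (summand ρ) ⟨
    trace * weight k ρ ∎
    where
    ρ = del v π
    split : ∀ j a → summand π (Vector.insertAt j v a) ≈ sgn (sign ρ (par ∘ j)) * prod (Vector.insertAt (entries ρ j) v (E a a))
    split j a = *-cong
      (reflexive (cong sgn (≡.trans (sign-loop v π perm πv≡v (par ∘ i)) (sign-cong ρ λ x → cong par (insertAt-punchIn j v a x)))))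
      (trans (prod-removeAt v (entries π i)) (prod-insertAt-cong v
        (λ x → reflexive (cong₂ E (insertAt-punchIn j v a x)
          (≡.trans (cong i (≡.sym (punchIn-del-loop v π perm πv≡v x))) (insertAt-punchIn j v a (lookup ρ x)))))
        (reflexive (cong₂ E (insertAt-lookup j v a) (≡.trans (cong i πv≡v) (insertAt-lookup j v a))))))
      where i = Vector.insertAt j v a
    collect : ∀ j → sumFin (λ a → sgn (sign ρ (par ∘ j)) * prod (Vector.insertAt (entries ρ j) v (E a a))) ≈ trace * summand ρ j
    collect j = begin
      sumFin (λ a → s * prod (Vector.insertAt g v (E a a)))
        ≈⟨ sumFin-*ˡ s (λ a → prod (Vector.insertAt g v (E a a))) ⟨
      s * sumFin (λ a → prod (Vector.insertAt g v (E a a)))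
        ≈⟨ *-congˡ (prod-insertAt-sumFin g v (λ a → E a a)) ⟨
      s * prod (Vector.insertAt g v trace)
        -- Writing `trace` as `trace * 1#` leaves a unit at position `v`, which then disappears.
        ≈⟨ *-congˡ (trans (prod-insertAt-cong v {trace} (λ _ → refl) (sym (*-identityʳ trace)))
             (trans (prod-insertAt-central g v trace 1# (λ y → trace-central _ _)) (*-congˡ (prod-insertAt-1 g v)))) ⟩
      s * (trace * prod g)
        ≈⟨ *-assoc _ _ _ ⟨
      s * trace * prod g
        ≈⟨ *-congʳ (sgn-central _ trace) ⟩
      trace * s * prod g
        ≈⟨ *-assoc _ _ _ ⟩
      trace * (s * prod g) ∎
      where
      g = entries ρ j
      s = sgn (sign ρ (par ∘ j))

  sum-one : ∀ k → sum {k} (λ _ → 1#) ≈ natR k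
  sum-one zero = refl
  sum-one (suc k) = +-congˡ (sum-one k)

  sum-minus-one : ∀ k → sum {k} (λ _ → - 1#) ≈ - natR k
  sum-minus-one zero = sym -0#≈0#
  sum-minus-one (suc k) = trans (+-congˡ (sum-minus-one k)) (-‿+-comm 1# (natR k))

  sum-++ : ∀ k {j} (f : Fin (k ℕ.+ j) → Carrier) → sum f ≈ sum (f ∘ (_↑ˡ j)) + sum (f ∘ (k ↑ʳ_))
  sum-++ zero f = sym (+-identityˡ _)
  sum-++ (suc k) f = trans (+-congˡ (sum-++ k (f ∘ suc))) (sym (+-assoc _ _ _))

  par-even : ∀ x → par (x ↑ˡ n) ≡ false
  par-even x rewrite Finₚ.toℕ-↑ˡ x n with m ≤ᵇ toℕ x in eq
  ... | false = ≡.refl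
  ... | true = contradiction (Finₚ.toℕ<n x) (ℕₚ.≤⇒≯ (ℕₚ.≤ᵇ⇒≤ m (toℕ x) (subst T (≡.sym eq) _)))

  par-odd : ∀ y → par (m ↑ʳ y) ≡ true
  par-odd y rewrite Finₚ.toℕ-↑ʳ m y with m ≤ᵇ m ℕ.+ toℕ y | ℕₚ.≤⇒≤ᵇ (ℕₚ.m≤m+n m (toℕ y))
  ... | true | _ = ≡.refl

  supertrace-value : supertrace ≈ natR m - natR n
  supertrace-value = begin
    supertrace
      ≡⟨ sumFin-sum (λ a → sgn (par a)) ⟩
    sum (λ a → sgn (par a))
      ≈⟨ sum-++ m (λ a → sgn (par a)) ⟩
    sum (λ x → sgn (par (x ↑ˡ n))) + sum (λ y → sgn (par (m ↑ʳ y)))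
      ≡⟨ cong₂ _+_ (Σ′.sum-cong-≗ λ x → cong sgn (par-even x)) (Σ′.sum-cong-≗ λ y → cong sgn (par-odd y)) ⟩
    sum {m} (λ _ → 1#) + sum {n} (λ _ → - 1#)
      ≈⟨ +-cong (sum-one m) (sum-minus-one n) ⟩
    natR m - natR n ∎

-- Reduction to a cycle followed by a smaller permutation

module _ {k} (l : Fin k) (σ : Perm (suc k)) (perm : IsPerm σ) (σv≡l : lookup σ (suc l) ≡ inject₁ l) where

  σ≢l : ∀ x → lookup σ (punchIn (suc l) x) ≢ inject₁ l
  σ≢l x eq = Finₚ.punchInᵢ≢i (suc l) x (perm _ _ (≡.trans eq (≡.sym σv≡l)))

  conjτ-step : lookup (conjτ l σ) (inject₁ l) ≡ suc l
  conjτ-step = ≡.trans (lookup-conjτ-inject₁ l σ) (≡.trans (cong (swapAt l) σv≡l) (swapAt-inject₁ l))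

  -- The passage `a → l+1 → l → b` of `σ` is `a → l → l+1 → b` in `τστ`, and both contract to the
  -- same single vertex on the way from `a` to `b`.
  D-conjτ : D l (conjτ l σ) ≡ D l σ
  D-conjτ = Perm-ext λ x → Finₚ.punchIn-injective (suc l) _ _
    (≡.trans (punchIn-D-step l (conjτ l σ) (IsPerm-conjτ l σ perm) x conjτ-step)
      (≡.trans (lookup-conjτ l σ (punchIn (inject₁ l) x))
        (≡.trans (cong (swapAt l ∘ lookup σ) (swap-punchIn x)) (agree x))))
    where
    swap-punchIn : ∀ x → swapAt l (punchIn (inject₁ l) x) ≡ punchIn (suc l) x
    swap-punchIn x = ≡.trans (cong (swapAt l) (≡.sym (swapAt-punchIn l x))) (swapAt-involutive l (punchIn (suc l) x))
    agree : ∀ x → swapAt l (lookup σ (punchIn (suc l) x)) ≡ punchIn (suc l) (lookup (D l σ) x)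
    agree x with lookup σ (punchIn (suc l) x) ≟ suc l
    ... | yes eq = ≡.trans (cong (swapAt l) eq) (≡.trans (swapAt-suc l)
            (≡.trans (≡.sym σv≡l) (≡.sym (punchIn-del-bypass (suc l) σ perm x eq))))
    ... | no neq = ≡.trans (swapAt-other l _ (σ≢l x) neq) (≡.sym (punchIn-del (suc l) σ perm x neq))

module _ {k} (l : Fin (suc k)) (σ : Perm (suc (suc k))) (perm : IsPerm σ)
  (σv≡l : lookup σ (suc l) ≡ inject₁ l) (σl≢v : lookup σ (inject₁ l) ≢ suc l) where

  private
    π₁ = D l (compτ l σ)
    π₂ = D l σ
    permπ₁ : IsPerm π₁
    permπ₁ = IsPerm-del (suc l) (compτ l σ) (IsPerm-compτ l σ perm)
    permπ₂ : IsPerm π₂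
    permπ₂ = IsPerm-del (suc l) σ perm

  -- The merged vertex emits the edge of `l+1` and receives the edge into `l`; here these are the
  -- same edge, which becomes a loop.
  D-compτ-loop : lookup (D l (compτ l σ)) l ≡ l
  D-compτ-loop = Finₚ.punchIn-injective (suc l) _ _ (≡.trans
    (punchIn-D l σ perm l λ eq → inject₁≢suc l (≡.trans (≡.sym σw≡l) eq))
    (≡.trans σw≡l (≡.sym (punchIn-suc-same l))))
    where
    σw≡l : lookup σ (punchIn (inject₁ l) l) ≡ inject₁ l
    σw≡l = ≡.trans (cong (lookup σ) (punchIn-inject₁-same l)) σv≡l

  -- Beside the loop, the edges `a → l+1` and `l → b` have been joined into `a → b`, which is also
  -- what bypassing `l+1` and then `l` produces.
  del-D-compτ : del l (D l (compτ l σ)) ≡ del l (D l σ)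
  del-D-compτ = Perm-ext λ x → Finₚ.punchIn-injective l _ _ (Finₚ.punchIn-injective (suc l) _ _ (≡.trans
    (cong (punchIn (suc l)) (punchIn-del-loop l π₁ permπ₁ D-compτ-loop x)) (agree x)))
    where
    agree : ∀ x → punchIn (suc l) (lookup π₁ (punchIn l x)) ≡ punchIn (suc l) (punchIn l (lookup (del l π₂) x))
    agree x = by-cases (lookup σ (punchIn (suc l) z) ≟ suc l)
      where
      z = punchIn l x
      same : punchIn (suc l) z ≡ punchIn (inject₁ l) z
      same = punchIn-suc-other l z (Finₚ.punchInᵢ≢i l x)
      by-cases : Dec (lookup σ (punchIn (suc l) z) ≡ suc l) →
        punchIn (suc l) (lookup π₁ z) ≡ punchIn (suc l) (punchIn l (lookup (del l π₂) x))
      by-cases (yes eq) = ≡.trans (punchIn-D-join l σ perm z (≡.trans (cong (lookup σ) (≡.sym same)) eq))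
        (≡.trans (cong (lookup σ) (≡.sym (punchIn-suc-same l)))
          (≡.trans (≡.sym (punchIn-del (suc l) σ perm l λ eq′ → σl≢v (≡.trans (cong (lookup σ) (≡.sym (punchIn-suc-same l))) eq′)))
            (cong (punchIn (suc l)) (≡.sym (punchIn-del-bypass l π₂ permπ₂ x π₂z≡l)))))
        where
        π₂z≡l : lookup π₂ z ≡ l
        π₂z≡l = Finₚ.punchIn-injective (suc l) _ _ (≡.trans (punchIn-del-bypass (suc l) σ perm z eq)
          (≡.trans σv≡l (≡.sym (punchIn-suc-same l))))
      by-cases (no neq) = ≡.trans (punchIn-D l σ perm z (neq ∘ ≡.trans (cong (lookup σ) same)))
        (≡.trans (cong (lookup σ) (≡.sym same))
          (≡.trans (≡.sym π₂z) (cong (punchIn (suc l)) (≡.sym (punchIn-del l π₂ permπ₂ x π₂z≢l)))))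
        where
        π₂z : punchIn (suc l) (lookup π₂ z) ≡ lookup σ (punchIn (suc l) z)
        π₂z = punchIn-del (suc l) σ perm z neq
        π₂z≢l : lookup π₂ z ≢ l
        π₂z≢l eq = σ≢l l σ perm σv≡l z (≡.trans (≡.sym π₂z) (≡.trans (cong (punchIn (suc l)) eq) (punchIn-suc-same l)))

PathTo : ∀ {k} → ℕ → Perm k → Set
PathTo p σ = ∀ x → toℕ x < p → toℕ (lookup σ x) ≡ suc (toℕ x)

swapAt-below : ∀ {k} (l : Fin k) x → toℕ x < toℕ l → swapAt l x ≡ x
swapAt-below l x x<l = swapAt-other l x
  (λ eq → ℕₚ.<-irrefl (≡.trans (cong toℕ eq) (Finₚ.toℕ-inject₁ l)) x<l)
  (λ eq → ℕₚ.<-asym x<l (subst (λ y → toℕ l < toℕ y) (≡.sym eq) (ℕₚ.n<1+n (toℕ l))))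

module _ {q k} (Q : Perm (suc k) → Set q)
  (close : ∀ p σ → IsPerm σ → PathTo p σ → ∀ x → toℕ x ≡ p → lookup σ x ≡ zero → Q σ)
  (conjugate : ∀ l σ → IsPerm σ → Q (conjτ l σ) → Q σ) where

  private
    -- The target of the end `p` of the path is lowered to `p+1`, with `d` the distance still to go.
    -- As long as it is `l+1` with `l > p`, conjugation at `l` lowers it by one and leaves the path
    -- alone, since both exchanged vertices lie beyond `p`.
    pull : ∀ d p σ → IsPerm σ → PathTo p σ → ∀ x → toℕ x ≡ p → toℕ (lookup σ x) ≡ suc (d ℕ.+ p) →
      (∀ ρ → IsPerm ρ → PathTo (suc p) ρ → Q ρ) → Q σ
    pull zero p σ perm path x x≡p σx≡ next = next σ perm extended
      where
      extended : PathTo (suc p) σ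
      extended y (s≤s y≤p) with ℕₚ.m≤n⇒m<n∨m≡n y≤p
      ... | inj₁ y<p = path y y<p
      ... | inj₂ y≡p with ≡.refl ← Finₚ.toℕ-injective (≡.trans y≡p (≡.sym x≡p)) = ≡.trans σx≡ (cong suc (≡.sym x≡p))
    pull (suc d) p σ perm path x x≡p σx≡ next with lookup σ x in σx
    ... | suc l = conjugate l σ perm
      (pull d p (conjτ l σ) (IsPerm-conjτ l σ perm) path′ x x≡p
        (≡.trans (cong toℕ σ′x) (≡.trans (Finₚ.toℕ-inject₁ l) l≡)) next)
      where
      l≡ : toℕ l ≡ suc (d ℕ.+ p)
      l≡ = ℕₚ.suc-injective σx≡
      p<l : p < toℕ l
      p<l = subst (p <_) (≡.sym l≡) (s≤s (ℕₚ.m≤n+m p d))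
      path′ : PathTo p (conjτ l σ)
      path′ y y<p = ≡.trans (cong toℕ (≡.trans (lookup-conjτ l σ y)
          (≡.trans (cong (swapAt l ∘ lookup σ) (swapAt-below l y (ℕₚ.<-trans y<p p<l)))
            (swapAt-below l (lookup σ y) (subst (_< toℕ l) (≡.sym (path y y<p)) (ℕₚ.≤-<-trans y<p p<l))))))
        (path y y<p)
      σ′x : lookup (conjτ l σ) x ≡ inject₁ l
      σ′x = ≡.trans (lookup-conjτ l σ x)
        (≡.trans (cong (swapAt l ∘ lookup σ) (swapAt-below l x (subst (_< toℕ l) (≡.sym x≡p) p<l)))
          (≡.trans (cong (swapAt l) σx) (swapAt-suc l)))

    extend : ∀ fuel p σ → fuel ℕ.+ p ≡ suc k → IsPerm σ → PathTo p σ → Q σ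
    -- A path of this length would send the last vertex `k` to `k+1`, which is out of range: the
    -- path must close up earlier.
    extend zero p σ ≡.refl perm path = contradiction
      (≡.trans (path (fromℕ k) (subst (_< suc k) (≡.sym (Finₚ.toℕ-fromℕ k)) (ℕₚ.n<1+n k))) (cong suc (Finₚ.toℕ-fromℕ k)))
      (ℕₚ.<⇒≢ (Finₚ.toℕ<n (lookup σ (fromℕ k))))
    extend (suc fuel) p σ eq perm path = by-cases (lookup σ x) ≡.refl
      where
      p<k : p < suc k
      p<k = subst (p <_) eq (s≤s (ℕₚ.m≤n+m p fuel))
      x = fromℕ< p<k
      x≡p : toℕ x ≡ p
      x≡p = Finₚ.toℕ-fromℕ< p<k
      by-cases : ∀ y → lookup σ x ≡ y → Q σ
      by-cases zero σx≡0 = close p σ perm path x x≡p σx≡0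
      by-cases (suc y) σx≡y with toℕ y ℕₚ.<? p
      -- The vertices `1, ..., p` are already targets of the path, so the end `p` can go only to 0
      -- or beyond `p`.
      ... | yes y<p = contradiction y<p (ℕₚ.<-irrefl (≡.trans (≡.sym (Finₚ.toℕ-inject₁ y)) (≡.trans (cong toℕ iy≡x) x≡p)))
        where
        iy<p : toℕ (inject₁ y) < p
        iy<p = subst (_< p) (≡.sym (Finₚ.toℕ-inject₁ y)) y<p
        iy≡x : inject₁ y ≡ x
        iy≡x = perm _ _ (Finₚ.toℕ-injective
          (≡.trans (path (inject₁ y) iy<p) (≡.trans (cong suc (Finₚ.toℕ-inject₁ y)) (cong toℕ (≡.sym σx≡y)))))
      ... | no y≮p = pull (toℕ y ℕ.∸ p) p σ perm path x x≡p
        (≡.trans (cong toℕ σx≡y) (cong suc (≡.sym (ℕₚ.m∸n+n≡m (ℕₚ.≮⇒≥ y≮p)))))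
        λ ρ permρ pathρ → extend fuel (suc p) ρ (≡.trans (ℕₚ.+-suc fuel p) eq) permρ pathρ

  conjugation-induction : ∀ σ → IsPerm σ → Q σ
  conjugation-induction σ perm = extend (suc k) 0 σ (ℕₚ.+-identityʳ (suc k)) perm λ x ()

toℕ-cyc : ∀ {p} (a : Fin (suc p)) → toℕ a < p → toℕ (cyc a) ≡ suc (toℕ a)
toℕ-cyc {suc p} zero _ = ≡.refl
toℕ-cyc {suc p} (suc a) (s≤s a<p) with cyc a | toℕ-cyc a a<p
... | suc _ | eq = cong suc eq

cyc-last : ∀ {p} (a : Fin (suc p)) → toℕ a ≡ p → cyc a ≡ zero
cyc-last {zero} zero _ = ≡.refl
cyc-last {suc p} (suc a) eq rewrite cyc-last a (ℕₚ.suc-injective eq) = ≡.refl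

cycle-splits : ∀ p r (σ : Perm (suc p ℕ.+ r)) → IsPerm σ → PathTo p σ → ∀ x → toℕ x ≡ p → lookup σ x ≡ zero →
  ∃ λ (ρ : Perm r) → IsPerm ρ × σ ≡ cyclePerm p ⊔ₚ ρ
cycle-splits p r σ perm path x x≡p σx≡0 = ρ , permρ , Perm-ext agree
  where
  left : ∀ a → lookup σ (a ↑ˡ r) ≡ cyc a ↑ˡ r
  left a with ℕₚ.m≤n⇒m<n∨m≡n (ℕₚ.≤-pred (Finₚ.toℕ<n a))
  ... | inj₁ a<p = Finₚ.toℕ-injective (≡.trans
      (path (a ↑ˡ r) (subst (_< p) (≡.sym (Finₚ.toℕ-↑ˡ a r)) a<p))
      (≡.trans (cong suc (Finₚ.toℕ-↑ˡ a r)) (≡.sym (≡.trans (Finₚ.toℕ-↑ˡ (cyc a) r) (toℕ-cyc a a<p)))))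
  ... | inj₂ a≡p = ≡.trans
      (cong (lookup σ) (Finₚ.toℕ-injective (≡.trans (Finₚ.toℕ-↑ˡ a r) (≡.trans a≡p (≡.sym x≡p)))))
      (≡.trans σx≡0 (cong (_↑ˡ r) (≡.sym (cyc-last a a≡p))))
  right : ∀ b → ∃ λ c → lookup σ (suc p ↑ʳ b) ≡ suc p ↑ʳ c
  right b with splitAt (suc p) (lookup σ (suc p ↑ʳ b)) in eq
  ... | inj₂ c = c , ≡.sym (Finₚ.splitAt⁻¹-↑ʳ eq)
  -- The right block cannot enter the left one: every left vertex already has its preimage on the
  -- cycle.
  ... | inj₁ a with preimage (cyclePerm p) (IsPerm-cyclePerm p) a
  ...   | a′ , cyc≡a = contradiction
    (perm _ _ (≡.trans (left a′) (≡.trans (cong (_↑ˡ r) (≡.trans (≡.sym (lookup-cyclePerm p a′)) cyc≡a)) (Finₚ.splitAt⁻¹-↑ˡ eq))))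
    λ same → contradiction (≡.trans (≡.sym (Finₚ.splitAt-↑ˡ (suc p) a′ r))
      (≡.trans (cong (splitAt (suc p)) same) (Finₚ.splitAt-↑ʳ (suc p) r b))) λ ()
  ρ : Perm r
  ρ = tabulate (proj₁ ∘ right)
  lookup-ρ : ∀ b → lookup σ (suc p ↑ʳ b) ≡ suc p ↑ʳ lookup ρ b
  lookup-ρ b = ≡.trans (proj₂ (right b)) (cong (suc p ↑ʳ_) (≡.sym (Vecₚ.lookup∘tabulate (proj₁ ∘ right) b)))
  permρ : IsPerm ρ
  permρ b c eq = Finₚ.↑ʳ-injective (suc p) b c (perm _ _
    (≡.trans (lookup-ρ b) (≡.trans (cong (suc p ↑ʳ_) eq) (≡.sym (lookup-ρ c)))))
  Agrees : Fin (suc p ℕ.+ r) → Set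
  Agrees y = lookup σ y ≡ lookup (cyclePerm p ⊔ₚ ρ) y
  agree : ∀ y → Agrees y
  agree y with splitAt (suc p) y in eq
  ... | inj₁ a = subst Agrees (Finₚ.splitAt⁻¹-↑ˡ eq)
    (≡.trans (left a) (≡.sym (≡.trans (lookup-⊔ₚˡ (cyclePerm p) ρ a) (cong (_↑ˡ r) (lookup-cyclePerm p a)))))
  ... | inj₂ b = subst Agrees (Finₚ.splitAt⁻¹-↑ʳ {suc p} eq)
    (≡.trans (lookup-ρ b) (≡.sym (lookup-⊔ₚʳ (cyclePerm p) ρ b)))

-- Comparison with the universal weight system

module Comparison {r ℓ p ℓp} (R : Ring r ℓ) (m n : ℕ) (E : Fin (m ℕ.+ n) → Fin (m ℕ.+ n) → Ring.Carrier R)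
  (relations : GlMN.SatisfiesRelations R m n E)
  (P : CommutativeRing p ℓp) (c : ℕ → CommutativeRing.Carrier P)
  (W : (k : ℕ) → Perm k → CommutativeRing.Carrier P) (universal : IsUniversalGlWS P c W)
  (Φ : CommutativeRing.Carrier P → Ring.Carrier R)
  (hom : RingMorphisms.IsRingHomomorphism (CommutativeRing.rawRing P) (Ring.rawRing R) Φ)
  (Φc₀ : Ring._≈_ R (Φ (c 0)) (Ring._-_ R (GlMN.natR R m n E m) (GlMN.natR R m n E n)))
  (Φc : ∀ j → Ring._≈_ R (Φ (c (suc j))) (GlMN.casimir R m n E j)) where

  private
    module P = CommutativeRing P
    module U = IsUniversalGlWS universal
  open Ring R hiding (zero)
  open GlMN R m n E
  open Algebra.Properties.Ring R
  open Weights R m n E relations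
  open Relation.Binary.Reasoning.Setoid setoid
  open RingMorphisms.IsRingHomomorphism hom

  Φ-- : ∀ x y → Φ (x P.- y) ≈ Φ x - Φ y
  Φ-- x y = trans (+-homo x (P.- y)) (+-congˡ (-‿homo y))

  cancel-right : ∀ {x y x′ y′} → x - y ≈ x′ - y′ → y ≈ y′ → x ≈ x′
  cancel-right {y′ = y′} eq y≈y′ = +-cancelʳ (- y′) _ _ (trans (+-congˡ (-‿cong (sym y≈y′))) eq)

  cancel-left : ∀ {x y x′ y′} → x - y ≈ x′ - y′ → x ≈ x′ → y ≈ y′
  cancel-left {x′ = x′} eq x≈x′ = -‿injective (+-cancelˡ x′ _ _ (trans (+-congʳ (sym x≈x′)) eq))

  Agrees : ∀ k → Perm k → Set ℓ
  Agrees k σ = weight k σ ≈ Φ (W k σ)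

  module _ {k} (agrees : ∀ j → j ≤ suc k → (σ : Perm j) → IsPerm σ → Agrees j σ)
    (l : Fin (suc k)) (σ : Perm (suc (suc k))) (perm : IsPerm σ) where

    private
      K : ℕ
      K = suc (suc k)
      σ′ = conjτ l σ
      perm′ = IsPerm-conjτ l σ perm
      agrees-D : ∀ π → IsPerm π → Agrees (suc k) (D l π)
      agrees-D π permπ = agrees (suc k) ℕₚ.≤-refl (D l π) (IsPerm-del (suc l) π permπ)

    difference-join : lookup σ (inject₁ l) ≢ suc l → lookup σ (suc l) ≢ inject₁ l →
      weight K σ - weight K σ′ ≈ Φ (W K σ) - Φ (W K σ′)
    difference-join σl≢v σv≢l = begin
      weight K σ - weight K σ′
        ≈⟨ weight-conjτ l σ perm ⟩
      merged l σ - merged l σ′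
        ≈⟨ +-cong (merged-join l σ perm σl≢v) (-‿cong (merged-join l σ′ perm′ σ′l≢v)) ⟩
      weight (suc k) (D l (compτ l σ)) - weight (suc k) (D l (compτ l σ′))
        ≈⟨ +-cong (agrees-D (compτ l σ) (IsPerm-compτ l σ perm)) (-‿cong (agrees-D (compτ l σ′) (IsPerm-compτ l σ′ perm′))) ⟩
      Φ (W (suc k) (D l (compτ l σ))) - Φ (W (suc k) (D l (compτ l σ′)))
        ≈⟨ Φ-- _ _ ⟨
      Φ (W (suc k) (D l (compτ l σ)) P.- W (suc k) (D l (compτ l σ′)))
        ≈⟨ ⟦⟧-cong (U.recur₁ l σ perm σl≢v σv≢l) ⟨
      Φ (W K σ P.- W K σ′)
        ≈⟨ Φ-- _ _ ⟩
      Φ (W K σ) - Φ (W K σ′) ∎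
      where
      σ′l≢v : lookup σ′ (inject₁ l) ≢ suc l
      σ′l≢v eq = σv≢l (swapAt-injective l
        (≡.trans (≡.sym (lookup-conjτ-inject₁ l σ)) (≡.trans eq (≡.sym (swapAt-inject₁ l)))))

    -- For `σ` the merge produces a loop and hence `trace`, the image of `c 1`; for `τστ` the edge
    -- `l → l+1` frees a label and yields `supertrace`, the image of `c 0`.
    difference-step : lookup σ (suc l) ≡ inject₁ l → lookup σ (inject₁ l) ≢ suc l →
      weight K σ - weight K σ′ ≈ Φ (W K σ) - Φ (W K σ′)
    difference-step σv≡l σl≢v = begin
      weight K σ - weight K σ′
        ≈⟨ weight-conjτ l σ perm ⟩
      merged l σ - merged l σ′
        ≈⟨ +-cong
             (trans (merged-join l σ perm σl≢v) (weight-loop l (D l (compτ l σ))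
               (IsPerm-del (suc l) (compτ l σ) (IsPerm-compτ l σ perm)) (D-compτ-loop l σ perm σv≡l σl≢v)))
             (-‿cong (merged-step l σ′ perm′ (conjτ-step l σ perm σv≡l))) ⟩
      trace * weight k (del l (D l (compτ l σ))) - supertrace * weight (suc k) (D l σ′)
        ≡⟨ cong₂ (λ π ρ → trace * weight k π - supertrace * weight (suc k) ρ)
             (del-D-compτ l σ perm σv≡l σl≢v) (D-conjτ l σ perm σv≡l) ⟩
      trace * weight k (del l (D l σ)) - supertrace * weight (suc k) (D l σ)
        ≈⟨ +-cong
             (*-cong (trans (sym casimir-trace) (sym (Φc 0)))
               (agrees k (ℕₚ.n≤1+n k) (del l (D l σ)) (IsPerm-del l (D l σ) (IsPerm-del (suc l) σ perm))))
             (-‿cong (*-cong (trans supertrace-value (sym Φc₀)) (agrees-D σ perm))) ⟩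
      Φ (c 1) * Φ (W k (del l (D l σ))) - Φ (c 0) * Φ (W (suc k) (D l σ))
        ≈⟨ +-cong (*-homo _ _) (-‿cong (*-homo _ _)) ⟨
      Φ (c 1 P.* W k (del l (D l σ))) - Φ (c 0 P.* W (suc k) (D l σ))
        ≈⟨ Φ-- _ _ ⟨
      Φ (c 1 P.* W k (del l (D l σ)) P.- c 0 P.* W (suc k) (D l σ))
        ≈⟨ ⟦⟧-cong (U.recur₂ l σ perm σv≡l σl≢v) ⟨
      Φ (W K σ P.- W K σ′)
        ≈⟨ Φ-- _ _ ⟩
      Φ (W K σ) - Φ (W K σ′) ∎

  agrees-conjτ : ∀ {k} → (∀ j → j ≤ suc k → (σ : Perm j) → IsPerm σ → Agrees j σ) →
    (l : Fin (suc k)) (σ : Perm (suc (suc k))) → IsPerm σ → Agrees _ (conjτ l σ) → Agrees _ σ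
  agrees-conjτ {k} agrees l σ perm σ′-agrees
    with lookup σ (inject₁ l) ≟ suc l | lookup σ (suc l) ≟ inject₁ l
  ... | no σl≢v | no σv≢l = cancel-right (difference-join agrees l σ perm σl≢v σv≢l) σ′-agrees
  ... | no σl≢v | yes σv≡l = cancel-right (difference-step agrees l σ perm σv≡l σl≢v) σ′-agrees
  -- Here the recurrence is read for `τστ`, which has the edge `l+1 → l`; its conjugate is `σ`, so
  -- agreement passes from the left term to the right one.
  ... | yes σl≡v | no σv≢l = subst (Agrees _) (conjτ-involutive l σ)
    (cancel-left (difference-step agrees l (conjτ l σ) (IsPerm-conjτ l σ perm)
      (≡.trans (lookup-conjτ-suc l σ) (≡.trans (cong (swapAt l) σl≡v) (swapAt-suc l)))
      (λ eq → σv≢l (swapAt-injective l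
        (≡.trans (≡.sym (lookup-conjτ-inject₁ l σ)) (≡.trans eq (≡.sym (swapAt-inject₁ l)))))))
      σ′-agrees)
  -- If `σ` exchanges `l` and `l+1`, it commutes with `τ`.
  ... | yes σl≡v | yes σv≡l = subst (Agrees _) (Perm-ext fixed) σ′-agrees
    where
    fixed : ∀ x → lookup (conjτ l σ) x ≡ lookup σ x
    fixed x with swapView l x
    ... | lower = ≡.trans (lookup-conjτ-inject₁ l σ)
      (≡.trans (cong (swapAt l) σv≡l) (≡.trans (swapAt-inject₁ l) (≡.sym σl≡v)))
    ... | upper = ≡.trans (lookup-conjτ-suc l σ)
      (≡.trans (cong (swapAt l) σl≡v) (≡.trans (swapAt-suc l) (≡.sym σv≡l)))
    ... | other x≢l x≢v = ≡.trans (lookup-conjτ l σ x)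
      (≡.trans (cong (swapAt l ∘ lookup σ) (swapAt-other l x x≢l x≢v))
        (swapAt-other l (lookup σ x)
          (λ eq → x≢v (perm _ _ (≡.trans eq (≡.sym σv≡l))))
          (λ eq → x≢l (perm _ _ (≡.trans eq (≡.sym σl≡v))))))

  agrees-cycle-⊔ₚ : ∀ p {r} (ρ : Perm r) → IsPerm ρ → Agrees r ρ → Agrees (suc p ℕ.+ r) (cyclePerm p ⊔ₚ ρ)
  agrees-cycle-⊔ₚ p {r} ρ permρ ρ-agrees = begin
    weight (suc p ℕ.+ r) (cyclePerm p ⊔ₚ ρ)
      ≈⟨ weight-⊔ₚ (cyclePerm p) ρ ⟩
    weight (suc p) (cyclePerm p) * weight r ρ
      ≈⟨ *-cong (trans (weight-cyclePerm p) (sym (Φc p))) ρ-agrees ⟩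
    Φ (c (suc p)) * Φ (W r ρ)
      ≈⟨ *-congʳ (⟦⟧-cong (U.cycle p)) ⟨
    Φ (W (suc p) (cyclePerm p)) * Φ (W r ρ)
      ≈⟨ *-homo _ _ ⟨
    Φ (W (suc p) (cyclePerm p) P.* W r ρ)
      ≈⟨ ⟦⟧-cong (U.concat (cyclePerm p) ρ (IsPerm-cyclePerm p) permρ) ⟨
    Φ (W (suc p ℕ.+ r) (cyclePerm p ⊔ₚ ρ)) ∎

  agrees-close : ∀ k → (∀ j → j ≤ k → (σ : Perm j) → IsPerm σ → Agrees j σ) →
    ∀ p σ → IsPerm σ → PathTo p σ → ∀ x → toℕ x ≡ p → lookup σ x ≡ zero → Agrees (suc k) σ
  agrees-close k agrees p σ perm path x x≡p σx≡0
    with ℕₚ.m≤n⇒∃[o]m+o≡n (ℕₚ.≤-pred (subst (_< suc k) x≡p (Finₚ.toℕ<n x)))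
  ... | r , ≡.refl with cycle-splits p r σ perm path x x≡p σx≡0
  ...   | ρ , permρ , ≡.refl = agrees-cycle-⊔ₚ p ρ permρ (agrees r (ℕₚ.m≤n+m r p) ρ permρ)

  -- Strong induction with the bound `b`: the recurrence lowers the size by one or two, but
  -- splitting off a cycle lowers it by the length of the cycle.
  agrees-below : ∀ b k → k ≤ b → (σ : Perm k) → IsPerm σ → Agrees k σ
  agrees-below b zero _ σ _ = trans (*-identityˡ 1#) (sym (trans (⟦⟧-cong (U.empty σ)) 1#-homo))
  agrees-below (suc b) (suc k) (s≤s k≤b) σ perm = conjugation-induction (Agrees (suc k))
    (agrees-close k below) (conjugate below) σ perm
    where
    below : ∀ j → j ≤ k → (σ : Perm j) → IsPerm σ → Agrees j σ
    below j j≤k = agrees-below b j (ℕₚ.≤-trans j≤k k≤b)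
    conjugate : ∀ {k} → (∀ j → j ≤ k → (σ : Perm j) → IsPerm σ → Agrees j σ) →
      ∀ l σ → IsPerm σ → Agrees (suc k) (conjτ l σ) → Agrees (suc k) σ
    -- An index `l` of an adjacent transposition exists only when there are at least two vertices.
    conjugate {suc k} below = agrees-conjτ below

open import Data.Nat using (_+_)

mainTheorem1 : {r ℓr p ℓp : Level} (m n : ℕ) → 1 ≤ m + n →
  (R : Ring r ℓr) (E : Fin (m + n) → Fin (m + n) → Ring.Carrier R) →
  GlMN.SatisfiesRelations R m n E →
  (P : CommutativeRing p ℓp) (c : ℕ → CommutativeRing.Carrier P)
  (W : (k : ℕ) → Perm k → CommutativeRing.Carrier P) → IsUniversalGlWS P c W →
  (Φ : CommutativeRing.Carrier P → Ring.Carrier R) →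
  RingMorphisms.IsRingHomomorphism (CommutativeRing.rawRing P) (Ring.rawRing R) Φ →
  Ring._≈_ R (Φ (c 0)) (Ring._-_ R (GlMN.natR R m n E m) (GlMN.natR R m n E n)) →
  ((j : ℕ) → Ring._≈_ R (Φ (c (suc j))) (GlMN.casimir R m n E j)) →
  (k : ℕ) (σ : Perm k) → IsPerm σ →
  Ring._≈_ R (GlMN.wglmn R m n E k σ) (Φ (W k σ))
mainTheorem1 m n _ R E relations P c W universal Φ hom Φc₀ Φc k σ perm =
  Ring.trans R (Weights.wglmn-weight R m n E relations k σ perm) (agrees-below k k ℕₚ.≤-refl σ perm)
  where open Comparison R m n E relations P c W universal Φ hom Φc₀ Φc
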